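{- Let $V$ be an irreducible vector configuration of rank $r$ with $\operatorname{Disc}(V)\le 2$. Then $V$ admits a codegree$^*$ decomposition of length at least $r-\operatorname{Disc}(V)$.
   Context: A vector configuration is a finite family $V$ of vectors in $\mathbb{R}^r$ (repetitions and copies of the zero vector allowed); subconfigurations are subfamilies, and all cardinalities $|\cdot|$ count multiplicities. The rank of $V$ is $\dim \operatorname{lin}(V)$. An oriented linear hyperplane $H$ is given by a nonzero linear functional $f$ on $\mathbb{R}^r$, with $H^+=\{f>0\}$, $H^-=\{f<0\}$, $\overline{H}^-=\{f\le 0\}$. The dual codegree is $\operatorname{codeg}^*(V)=\min_H|\overline{H}^-\cap V|$ and the covector discrepancy is $\operatorname{Disc}(V)=\max_H\big(|H^+\cap V|-|H^-\cap V|\big)$, both over all oriented linear hyperplanes (these quantities are also applied to subfamilies). $V$ is irreducible if it contains no copy of the zero vector. A codegree$^*$ decomposition of length $m$ of $V$ is a partition $V=V_0\uplus V_1\uplus\dots\uplus V_m$ into subfamilies ($V_0$ possibly empty) such that $\operatorname{codeg}^*(V_i)\ge 1$ for $1\le i\le m$ and $\operatorname{codeg}^*(V)=\sum_{i=1}^m\operatorname{codeg}^*(V_i)$. -}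

module Defs where

open import Level using (Level; _⊔_) renaming (suc to lsuc)
open import Data.Nat as ℕ using (ℕ; zero; suc)
open import Data.Integer as ℤ using (ℤ)
open import Data.Fin as Fin using (Fin)
open import Data.Fin.Properties using () renaming (_≟_ to _≟ᶠ_)
open import Data.List using (List; length; filter; map; lookup; allFin)
open import Data.List.Membership.Propositional using (_∈_)
open import Data.List.Relation.Binary.Sublist.Propositional using (_⊆_)
open import Data.Product using (Σ; ∃; _×_)
open import Relation.Nullary using (¬_)
open import Relation.Binary using (Rel)
open import Relation.Binary.Structures using (IsStrictTotalOrder)
open import Relation.Binary.PropositionalEquality using (_≡_)
open import Algebra.Bundles using (CommutativeRing)

-- An ordered field: a commutative ring with a strict total order compatible
-- with + and *, in which every nonzero element is invertible.  (ℝ is an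
-- instance; the theorem is stated for every ordered field.)
record OrderedField (c ℓ₁ ℓ₂ : Level) : Set (lsuc (c ⊔ ℓ₁ ⊔ ℓ₂)) where
  field
    commutativeRing : CommutativeRing c ℓ₁
  open CommutativeRing commutativeRing public
  field
    _<_                : Rel Carrier ℓ₂
    isStrictTotalOrder : IsStrictTotalOrder _≈_ _<_
    +-mono-<           : ∀ {x y} z → x < y → (x + z) < (y + z)
    *-pos              : ∀ {x y} → 0# < x → 0# < y → 0# < (x * y)
    0≉1                : ¬ (0# ≈ 1#)
    inverse            : ∀ x → ¬ (x ≈ 0#) → Σ Carrier (λ y → (x * y) ≈ 1#)
  open IsStrictTotalOrder isStrictTotalOrder public using (_<?_)

module _ {c ℓ₁ ℓ₂} (F : OrderedField c ℓ₁ ℓ₂) where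
  open OrderedField F

  Vector : ℕ → Set c
  Vector d = Fin d → Carrier

  ∑ : ∀ {n} → (Fin n → Carrier) → Carrier
  ∑ {zero}  f = 0#
  ∑ {suc n} f = f Fin.zero + ∑ (λ i → f (Fin.suc i))

  ⟪_,_⟫ : ∀ {d} → Vector d → Vector d → Carrier
  ⟪ h , v ⟫ = ∑ (λ i → h i * v i)

  -- vector configuration: finite family (with multiplicities) of vectors
  Config : ℕ → Set c
  Config d = List (Vector d)

  IsZeroVec : ∀ {d} → Vector d → Set ℓ₁
  IsZeroVec v = ∀ i → v i ≈ 0#

  -- an oriented linear hyperplane is given by a nonzero functional
  NonzeroFunctional : ∀ {d} → Vector d → Set ℓ₁
  NonzeroFunctional h = ¬ IsZeroVec h

  posCount : ∀ {d} → Vector d → Config d → ℕ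
  posCount h V = length (filter (λ v → 0# <? ⟪ h , v ⟫) V)

  negCount : ∀ {d} → Vector d → Config d → ℕ
  negCount h V = length (filter (λ v → ⟪ h , v ⟫ <? 0#) V)

  nonposCount : ∀ {d} → Vector d → Config d → ℕ
  nonposCount h V = length V ℕ.∸ posCount h V

  IsCodegStar : ∀ {d} → Config d → ℕ → Set (c ⊔ ℓ₁)
  IsCodegStar V k =
    (∃ λ h → NonzeroFunctional h × nonposCount h V ≡ k) ×
    (∀ h → NonzeroFunctional h → k ℕ.≤ nonposCount h V)

  CodegStarPositive : ∀ {d} → Config d → Set (c ⊔ ℓ₁)
  CodegStarPositive V = ∀ h → NonzeroFunctional h → 1 ℕ.≤ nonposCount h V

  discValue : ∀ {d} → Vector d → Config d → ℤ
  discValue h V = ℤ.+ posCount h V ℤ.- ℤ.+ negCount h V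

  IsDisc : ∀ {d} → Config d → ℤ → Set (c ⊔ ℓ₁)
  IsDisc V δ =
    (∃ λ h → NonzeroFunctional h × discValue h V ≡ δ) ×
    (∀ h → NonzeroFunctional h → discValue h V ℤ.≤ δ)

  Irreducible : ∀ {d} → Config d → Set (c ⊔ ℓ₁)
  Irreducible V = ∀ {v} → v ∈ V → ¬ IsZeroVec v

  LinIndep : ∀ {d} → Config d → Set (c ⊔ ℓ₁)
  LinIndep {d} W = ∀ (a : Fin (length W) → Carrier) →
    (∀ (i : Fin d) → ∑ (λ j → a j * lookup W j i) ≈ 0#) → ∀ j → a j ≈ 0#

  IsRank : ∀ {d} → Config d → ℕ → Set (c ⊔ ℓ₁)
  IsRank V r =
    (∃ λ W → W ⊆ V × LinIndep W × length W ≡ r) ×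
    (∀ W → W ⊆ V → LinIndep W → length W ℕ.≤ r)

  part : ∀ {d m} (V : Config d) → (Fin (length V) → Fin (suc m)) → Fin (suc m) → Config d
  part V lab i = map (lookup V) (filter (λ j → lab j ≟ᶠ i) (allFin (length V)))

  sumℕ : ∀ {n} → (Fin n → ℕ) → ℕ
  sumℕ {zero}  f = 0
  sumℕ {suc n} f = f Fin.zero ℕ.+ sumℕ (λ i → f (Fin.suc i))

  -- codegree* decomposition of length m: V = V₀ ⊎ V₁ ⊎ … ⊎ V_m with
  -- codeg*(V_i) ≥ 1 for 1 ≤ i ≤ m and codeg*(V) = Σ_{i=1}^m codeg*(V_i)
  CodegStarDecomposition : ∀ {d} → Config d → ℕ → Set (c ⊔ ℓ₁)
  CodegStarDecomposition {d} V m =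
    Σ (Fin (length V) → Fin (suc m)) λ lab →
      (∀ (i : Fin m) → CodegStarPositive (part V lab (Fin.suc i))) ×
      Σ (Fin m → ℕ) λ k →
        (∀ (i : Fin m) → IsCodegStar (part V lab (Fin.suc i)) (k i)) ×
        IsCodegStar V (sumℕ k)

{-# OPTIONS --safe #-}

-- For a family Y and a functional h put disc Y h = Σ sgn h(y).  If Disc(Y) ≤ D, then
-- perturbing h generically gives |disc Y h| + |disc (Y ∩ ker h) g| ≤ D for all h, g; hence
-- flats inherit the bound, and it drops by one when h kills an element.
--
-- Antiparallel pairs do not change disc, so V is a union of p such pairs, each of
-- codegree* 1, and a family U without antiparallel elements.  Evaluate disc U h, for h
-- with h(c) > 0, line by line through c ∈ U: a line contributes at most the excess of its
-- own disc over that of c, and loses one more if h kills an element of it other than c.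
-- * If Disc(U) ≤ 1 and c, y, z ∈ U were independent, an h killing y and z would have
--   disc U h < 0, whereas disc U h = 0.  So U has rank at most 2.
-- * If Disc(U) = 2 and U has rank at least 4, the same count with three killed elements
--   shows that c is not doubled.  Modulo c the family has discrepancy 1, hence it consists
--   of antiparallel pairs and a part of rank at most 2, spanning G with c.  All lines
--   through c outside G are odd, and the count leaves only one of them, L.  So U is the
--   union of U ∩ L and U ∖ L, both of discrepancy 1 and therefore of rank at most 2.
-- A family of 2k + e elements with Disc = e has codegree* k, and Steinitz bounds the rank.
module Submission where

open import Defs
open import Level as Level using (Level; _⊔_) renaming (suc to lsuc)
open import Data.Nat as ℕ using (ℕ; zero; suc; s≤s; z≤n)
open import Data.Nat.Properties as ℕₚ using ()
import Data.Nat.Solver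
open import Data.Integer as ℤ using (ℤ; +_; -[1+_]; 0ℤ; 1ℤ; -1ℤ; +≤+; -≤+)
open import Data.Integer.Properties as ℤₚ using ()
open import Data.Integer.Solver using (module +-*-Solver)
open import Data.Fin as Fin using (Fin)
open import Data.Fin.Properties as Finₚ using () renaming (_≟_ to _≟ᶠ_)
open import Data.List using (List; []; _∷_; [_]; _++_; _ʳ++_; length; filter; map; lookup; reverse; concat; allFin; tabulate)
open import Data.List.Properties using (length-filter; length-++; length-map; length-reverse; unfold-reverse; ++-identityʳ; filter-++; filter-none; filter-all; filter-accept; map-tabulate; map-∘; map-++; map-id)
open import Data.List.Membership.Propositional using (_∈_; find)
open import Data.List.Membership.Propositional.Properties using (∈-filter⁺; ∈-filter⁻; ∈-∃++; ∈-++⁺ˡ; ∈-++⁺ʳ; ∈-++⁻)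
open import Data.List.Relation.Unary.Any using (here; there)
open import Data.List.Relation.Unary.Any.Properties using (reverse⁻)
open import Data.List.Relation.Unary.All as All using (All; []; _∷_; all?)
open import Data.List.Relation.Unary.All.Properties using (¬All⇒Any¬) renaming (map⁺ to All-map⁺; ++⁺ to All-++⁺)
open import Data.List.Relation.Unary.AllPairs using (AllPairs; []; _∷_)
open import Data.List.Relation.Binary.Sublist.Propositional as Sublist using (_⊆_)
open import Data.List.Relation.Binary.Permutation.Propositional as Perm using (_↭_; ↭-refl; ↭-reflexive; ↭-sym; ↭-trans; prep)
open import Data.List.Relation.Binary.Permutation.Propositional.Properties using (shift; shifts; ∈-resp-↭; ++⁺ˡ; filter-↭; ↭-length; ↭-map-inv; map⁺) renaming (++-identityʳ to Perm-++-identityʳ)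
open import Data.Product using (Σ; ∃; _×_; _,_; proj₁; proj₂)
open import Data.Sum using (_⊎_; inj₁; inj₂)
open import Data.Unit.Polymorphic using (⊤; tt)
open import Data.Empty using (⊥; ⊥-elim)
open import Function using (_∘_)
open import Relation.Nullary using (¬_; Dec; yes; no; ¬?; contradiction; _×-dec_)
open import Relation.Unary using (Pred; Decidable)
open import Relation.Binary using (tri<; tri≈; tri>; IsStrictTotalOrder)
open import Relation.Binary.PropositionalEquality using (_≡_; _≢_; refl; sym; trans; cong; cong₂; subst; subst₂; module ≡-Reasoning)
import Algebra.Properties.Ring
import Relation.Binary.Reasoning.Setoid

-- Integer sums over lists, and sums over the classes of a relation.

private variable
  a p q r : Level
  A : Set a

module ℤ-Solver = +-*-Solver

sumBy : {A : Set a} → (A → ℤ) → List A → ℤ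
sumBy w []       = 0ℤ
sumBy w (x ∷ xs) = w x ℤ.+ sumBy w xs

sumBy-++ : (w : A → ℤ) (xs ys : List A) → sumBy w (xs ++ ys) ≡ sumBy w xs ℤ.+ sumBy w ys
sumBy-++ w []       ys = sym (ℤₚ.+-identityˡ _)
sumBy-++ w (x ∷ xs) ys = trans (cong (λ s → w x ℤ.+ s) (sumBy-++ w xs ys)) (sym (ℤₚ.+-assoc (w x) _ _))

sumBy-↭ : (w : A → ℤ) {xs ys : List A} → xs ↭ ys → sumBy w xs ≡ sumBy w ys
sumBy-↭ w Perm.refl          = refl
sumBy-↭ w (Perm.prep x p)    = cong (λ s → w x ℤ.+ s) (sumBy-↭ w p)
sumBy-↭ w {ys = _ ∷ _ ∷ ys} (Perm.swap x y p) = trans (cong (λ s → w x ℤ.+ (w y ℤ.+ s)) (sumBy-↭ w p))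
  (ℤ-Solver.solve 3 (λ a b c → a :+ (b :+ c) := b :+ (a :+ c)) refl (w x) (w y) (sumBy w ys))
  where open ℤ-Solver
sumBy-↭ w (Perm.trans p q)   = trans (sumBy-↭ w p) (sumBy-↭ w q)

sumBy-cong : {w w′ : A → ℤ} (xs : List A) → (∀ {x} → x ∈ xs → w x ≡ w′ x) → sumBy w xs ≡ sumBy w′ xs
sumBy-cong []       eq = refl
sumBy-cong (x ∷ xs) eq = cong₂ ℤ._+_ (eq (here refl)) (sumBy-cong xs (λ x∈ → eq (there x∈)))

sumBy-0 : {w : A → ℤ} (xs : List A) → (∀ {x} → x ∈ xs → w x ≡ 0ℤ) → sumBy w xs ≡ 0ℤ
sumBy-0 []       eq = refl
sumBy-0 (x ∷ xs) eq = cong₂ ℤ._+_ (eq (here refl)) (sumBy-0 xs (λ x∈ → eq (there x∈)))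

sumBy-neg : (w : A → ℤ) (xs : List A) → sumBy (λ x → ℤ.- w x) xs ≡ ℤ.- sumBy w xs
sumBy-neg w []       = refl
sumBy-neg w (x ∷ xs) = trans (cong (λ s → ℤ.- w x ℤ.+ s) (sumBy-neg w xs)) (sym (ℤₚ.neg-distrib-+ (w x) _))

sumBy-1 : {w : A → ℤ} (xs : List A) → (∀ {x} → x ∈ xs → w x ≡ 1ℤ) → sumBy w xs ≡ + length xs
sumBy-1 []       eq = refl
sumBy-1 (x ∷ xs) eq = cong₂ ℤ._+_ (eq (here refl)) (sumBy-1 xs (λ x∈ → eq (there x∈)))

module _ {A : Set a} {P : Pred A p} {Q : Pred A q} (P? : Decidable P) (Q? : Decidable Q) where

  filter-cong-∈ : (xs : List A) → (∀ {x} → x ∈ xs → P x → Q x) → (∀ {x} → x ∈ xs → Q x → P x) →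
                  filter P? xs ≡ filter Q? xs
  filter-cong-∈ []       _   _   = refl
  filter-cong-∈ (x ∷ xs) P⇒Q Q⇒P with P? x | Q? x
  ... | yes _  | yes _  = cong (x ∷_) (filter-cong-∈ xs (λ x∈ → P⇒Q (there x∈)) (λ x∈ → Q⇒P (there x∈)))
  ... | no _   | no _   = filter-cong-∈ xs (λ x∈ → P⇒Q (there x∈)) (λ x∈ → Q⇒P (there x∈))
  ... | yes px | no ¬qx = contradiction (P⇒Q (here refl) px) ¬qx
  ... | no ¬px | yes qx = contradiction (Q⇒P (here refl) qx) ¬px

  filter-filter-⇒ : (xs : List A) → (∀ {x} → x ∈ xs → Q x → P x) →
                     filter Q? (filter P? xs) ≡ filter Q? xs
  filter-filter-⇒ []       _   = refl
  filter-filter-⇒ (x ∷ xs) Q⇒P with P? x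
  ... | yes _ with Q? x
  ...   | yes _ = cong (x ∷_) (filter-filter-⇒ xs (λ x∈ → Q⇒P (there x∈)))
  ...   | no _  = filter-filter-⇒ xs (λ x∈ → Q⇒P (there x∈))
  filter-filter-⇒ (x ∷ xs) Q⇒P | no ¬px with Q? x
  ...   | yes qx = contradiction (Q⇒P (here refl) qx) ¬px
  ...   | no _   = filter-filter-⇒ xs (λ x∈ → Q⇒P (there x∈))

  filter-filter-× : (xs : List A) → filter Q? (filter P? xs) ≡ filter (λ x → P? x ×-dec Q? x) xs
  filter-filter-× []       = refl
  filter-filter-× (x ∷ xs) with P? x
  ... | no _  = filter-filter-× xs
  ... | yes _ with Q? x
  ...   | yes _ = cong (x ∷_) (filter-filter-× xs)
  ...   | no _  = filter-filter-× xs

module _ {A : Set a} {P : Pred A p} (P? : Decidable P) where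

  filter-↭-++ : (xs : List A) → xs ↭ filter P? xs ++ filter (λ x → ¬? (P? x)) xs
  filter-↭-++ []       = ↭-refl
  filter-↭-++ (x ∷ xs) with P? x
  ... | yes _ = prep x (filter-↭-++ xs)
  ... | no _  = ↭-trans (prep x (filter-↭-++ xs)) (↭-sym (shift x (filter P? xs) _))

  sumBy-filter : (w : A → ℤ) (xs : List A) →
                 sumBy w xs ≡ sumBy w (filter P? xs) ℤ.+ sumBy w (filter (λ x → ¬? (P? x)) xs)
  sumBy-filter w xs = trans (sumBy-↭ w (filter-↭-++ xs)) (sumBy-++ w (filter P? xs) _)

sumBy-filter-⊎ : {A : Set a} {P : Pred A p} {Q : Pred A q} {R : Pred A r}
  (P? : Decidable P) (Q? : Decidable Q) (R? : Decidable R) (w : A → ℤ) (xs : List A) →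
  (∀ {x} → x ∈ xs → P x → ¬ Q x → R x) → (∀ {x} → x ∈ xs → Q x → P x) → (∀ {x} → x ∈ xs → R x → P x × ¬ Q x) →
  sumBy w (filter P? xs) ≡ sumBy w (filter Q? xs) ℤ.+ sumBy w (filter R? xs)
sumBy-filter-⊎ P? Q? R? w xs P∖Q⇒R Q⇒P R⇒P∖Q =
  trans (sumBy-filter Q? w (filter P? xs)) (cong₂ ℤ._+_
    (cong (sumBy w) (filter-filter-⇒ P? Q? xs Q⇒P))
    (cong (sumBy w) (trans
      (filter-cong-∈ (λ x → ¬? (Q? x)) R? (filter P? xs)
        (λ x∈ → let x∈xs , px = ∈-filter⁻ P? x∈ in P∖Q⇒R x∈xs px)
        (λ x∈ rx → proj₂ (R⇒P∖Q (proj₁ (∈-filter⁻ P? {xs = xs} x∈)) rx)))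
      (filter-filter-⇒ P? R? xs (λ x∈ rx → proj₁ (R⇒P∖Q x∈ rx))))))

pairs : List (A × A) → List A
pairs []             = []
pairs ((y , z) ∷ ps) = y ∷ z ∷ pairs ps

∈⇒↭∷ : {x : A} {xs : List A} → x ∈ xs → ∃ λ ys → xs ↭ x ∷ ys
∈⇒↭∷ {x = x} x∈ with ys , zs , refl ← ∈-∃++ x∈ = ys ++ zs , shift x ys zs

module _ {A : Set a} {_~_ : A → A → Set p} (_~?_ : ∀ x y → Dec (x ~ y)) (~-refl : ∀ {x} → x ~ x) (w : A → ℤ) where

  private
    class : A → List A → List A
    class t = filter (t ~?_)
    rest : A → List A → List A
    rest t = filter (λ y → ¬? (t ~? y))

    -- What is required of `_~_` for the removal of the class of `t` to leave the class of every
    -- remaining element whole. It is asked only of members of `ys`: the relation used later, lying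
    -- on a common line through a point, is symmetric only away from that point.
    Separated : List A → Set _
    Separated ys = ∀ {t y z} → t ∈ ys → y ∈ ys → z ∈ ys → ¬ (t ~ y) → y ~ z → ¬ (t ~ z)

    class-rest : ∀ {t ys y} → Separated ys → t ∈ ys → y ∈ rest t ys → class y (rest t ys) ≡ class y ys
    class-rest {t} {ys} {y} sep t∈ y∈ = filter-filter-⇒ (λ z → ¬? (t ~? z)) (y ~?_) ys
      (λ z∈ y~z → sep t∈ (proj₁ y∈×) z∈ (proj₂ y∈×) y~z)
      where y∈× = ∈-filter⁻ (λ z → ¬? (t ~? z)) {xs = ys} y∈

    rest⊆ : ∀ {t ys y} → y ∈ rest t ys → y ∈ ys
    rest⊆ {t} {ys} y∈ = proj₁ (∈-filter⁻ (λ z → ¬? (t ~? z)) {xs = ys} y∈)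

  -- Removes the class of the first element again and again. The bound `n` on the length drives the
  -- recursion, since `rest` is not a structural sublist.
  sum-classes-≤0 : ∀ n ys → length ys ℕ.≤ n → Separated ys →
    (∀ {y} → y ∈ ys → sumBy w (class y ys) ℤ.≤ 0ℤ) → sumBy w ys ℤ.≤ 0ℤ
  sum-classes-≤0 n       []       _         _   _  = ℤₚ.≤-refl
  sum-classes-≤0 (suc n) (y ∷ ys) (s≤s len) sep cl = begin
    sumBy w (y ∷ ys)                                          ≡⟨ sumBy-filter (y ~?_) w (y ∷ ys) ⟩
    sumBy w (class y (y ∷ ys)) ℤ.+ sumBy w (rest y (y ∷ ys))  ≤⟨ ℤₚ.+-mono-≤ (cl (here refl)) ih ⟩
    0ℤ                                                        ∎
    where
    open ℤₚ.≤-Reasoning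
    shorter : length (rest y (y ∷ ys)) ℕ.≤ length ys
    shorter with y ~? y
    ... | yes _   = length-filter (λ z → ¬? (y ~? z)) ys
    ... | no ¬y~y = contradiction ~-refl ¬y~y
    ih : sumBy w (rest y (y ∷ ys)) ℤ.≤ 0ℤ
    ih = sum-classes-≤0 n (rest y (y ∷ ys)) (ℕₚ.≤-trans shorter len)
      (λ t∈ u∈ v∈ → sep (rest⊆ t∈) (rest⊆ u∈) (rest⊆ v∈))
      (λ z∈ → subst (λ l → sumBy w l ℤ.≤ 0ℤ) (sym (class-rest sep (here refl) z∈)) (cl (rest⊆ z∈)))

  -- Each `t` represents a class of its own that costs one; these classes are split off first, and
  -- the remaining ones add nothing positive.
  sum-classes : ∀ ts ys → Separated ys → (∀ {y} → y ∈ ys → sumBy w (class y ys) ℤ.≤ 0ℤ) →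
    AllPairs (λ t t′ → ¬ (t ~ t′)) ts → All (λ t → t ∈ ys × sumBy w (class t ys) ℤ.≤ -1ℤ) ts →
    sumBy w ys ℤ.≤ ℤ.- (+ length ts)
  sum-classes []       ys sep cl _          _                = sum-classes-≤0 (length ys) ys ℕₚ.≤-refl sep cl
  sum-classes (t ∷ ts) ys sep cl (t≁ ∷ ts≁) ((t∈ , t≤) ∷ ts∈) = begin
    sumBy w ys                                     ≡⟨ sumBy-filter (t ~?_) w ys ⟩
    sumBy w (class t ys) ℤ.+ sumBy w (rest t ys)   ≤⟨ ℤₚ.+-mono-≤ t≤ ih ⟩
    -1ℤ ℤ.+ (ℤ.- (+ length ts))                    ≡⟨ ℤₚ.neg-distrib-+ 1ℤ (+ length ts) ⟨
    ℤ.- (+ suc (length ts))                        ∎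
    where
    open ℤₚ.≤-Reasoning
    ih : sumBy w (rest t ys) ℤ.≤ ℤ.- (+ length ts)
    ih = sum-classes ts (rest t ys)
      (λ t∈ u∈ v∈ → sep (rest⊆ t∈) (rest⊆ u∈) (rest⊆ v∈))
      (λ z∈ → subst (λ l → sumBy w l ℤ.≤ 0ℤ) (sym (class-rest sep t∈ z∈)) (cl (rest⊆ z∈)))
      ts≁
      (All.zipWith (λ { {t′} (t≁t′ , t′∈ , t′≤) →
          let t′∈rest = ∈-filter⁺ (λ z → ¬? (t ~? z)) t′∈ t≁t′ in
          t′∈rest , subst (λ l → sumBy w l ℤ.≤ -1ℤ) (sym (class-rest sep t∈ t′∈rest)) t′≤ }) (t≁ , ts∈))

-- Signs in an ordered field, and spaces seen through their functionals.

module Sign {c ℓ₁ ℓ₂} (F : OrderedField c ℓ₁ ℓ₂) where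
  open OrderedField F public renaming (refl to ≈-refl; sym to ≈-sym; trans to ≈-trans)
  open IsStrictTotalOrder isStrictTotalOrder public using (compare; _≟_) renaming (trans to <-trans; irrefl to <-irrefl; asym to <-asym; <-respˡ-≈ to <-respˡ; <-respʳ-≈ to <-respʳ)
  open Algebra.Properties.Ring ring public using (-‿involutive; -‿distribˡ-*; -‿distribʳ-*; -0#≈0#; +-inverseˡ-unique; -1*x≈-x)
  open import Algebra.Properties.CommutativeSemigroup *-commutativeSemigroup public using (x∙yz≈y∙xz)
  module ≈-R = Relation.Binary.Reasoning.Setoid setoid

  opaque
    zero? : ∀ x → Dec (x ≈ 0#)
    zero? x = x ≟ 0#

  neg-pos : ∀ {x} → 0# < x → (- x) < 0#
  neg-pos {x} 0<x = <-respˡ (+-identityˡ (- x)) (<-respʳ (-‿inverseʳ x) (+-mono-< (- x) 0<x))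

  neg-neg : ∀ {x} → x < 0# → 0# < (- x)
  neg-neg {x} x<0 = <-respˡ (-‿inverseʳ x) (<-respʳ (+-identityˡ (- x)) (+-mono-< (- x) x<0))

  neg-pos⁻¹ : ∀ {x} → 0# < (- x) → x < 0#
  neg-pos⁻¹ {x} p = <-respˡ (-‿involutive x) (neg-pos p)

  neg*pos : ∀ {x y} → x < 0# → 0# < y → (x * y) < 0#
  neg*pos {x} {y} x<0 0<y = neg-pos⁻¹ (<-respʳ (≈-sym (-‿distribˡ-* x y)) (*-pos (neg-neg x<0) 0<y))

  <⇒0<- : ∀ {x y} → x < y → 0# < (y - x)
  <⇒0<- {x} {y} x<y = <-respˡ (-‿inverseʳ x) (+-mono-< (- x) x<y)

  0<1 : 0# < 1#
  0<1 with compare 0# 1#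
  ... | tri< p _ _ = p
  ... | tri≈ _ p _ = contradiction p 0≉1
  ... | tri> _ _ p = contradiction (<-respʳ (≈-trans (≈-sym (-‿distribˡ-* 1# (- 1#))) (≈-trans (-‿cong (*-identityˡ _)) (-‿involutive 1#))) (*-pos (neg-neg p) (neg-neg p))) (<-asym p)

  x<x+1 : ∀ x → x < (x + 1#)
  x<x+1 x = <-respˡ (+-identityˡ x) (<-respʳ (+-comm 1# x) (+-mono-< x 0<1))

  sgn : Carrier → ℤ
  sgn x with compare x 0#
  ... | tri< _ _ _ = -1ℤ
  ... | tri≈ _ _ _ = 0ℤ
  ... | tri> _ _ _ = 1ℤ

  sgn-neg : ∀ {x} → x < 0# → sgn x ≡ -1ℤ
  sgn-neg {x} p with compare x 0#
  ... | tri< _ _ _ = refl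
  ... | tri≈ ¬p _ _ = contradiction p ¬p
  ... | tri> ¬p _ _ = contradiction p ¬p

  sgn-zero : ∀ {x} → x ≈ 0# → sgn x ≡ 0ℤ
  sgn-zero {x} p with compare x 0#
  ... | tri< _ ¬p _ = contradiction p ¬p
  ... | tri≈ _ _ _ = refl
  ... | tri> _ ¬p _ = contradiction p ¬p

  sgn-pos : ∀ {x} → 0# < x → sgn x ≡ 1ℤ
  sgn-pos {x} p with compare x 0#
  ... | tri< _ _ ¬p = contradiction p ¬p
  ... | tri≈ _ _ ¬p = contradiction p ¬p
  ... | tri> _ _ _ = refl

  sgn-zero⁻¹ : ∀ {x} → sgn x ≡ 0ℤ → x ≈ 0#
  sgn-zero⁻¹ {x} eq with compare x 0#
  ... | tri≈ _ p _ = p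

  sgn-cong : ∀ {x y} → x ≈ y → sgn x ≡ sgn y
  sgn-cong {x} {y} x≈y with compare x 0#
  ... | tri< p _ _ = sym (sgn-neg (<-respˡ x≈y p))
  ... | tri≈ _ p _ = sym (sgn-zero (≈-trans (≈-sym x≈y) p))
  ... | tri> _ _ p = sym (sgn-pos (<-respʳ x≈y p))

  sgn-‿ : ∀ x → sgn (- x) ≡ ℤ.- sgn x
  sgn-‿ x with compare x 0#
  ... | tri< p _ _ = sgn-pos (neg-neg p)
  ... | tri≈ _ p _ = sgn-zero (≈-trans (-‿cong p) -0#≈0#)
  ... | tri> _ _ p = sgn-neg (neg-pos p)

  sgn-*-pos : ∀ x {l} → 0# < l → sgn (x * l) ≡ sgn x
  sgn-*-pos x {l} 0<l with compare x 0#
  ... | tri< p _ _ = sgn-neg (neg*pos p 0<l)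
  ... | tri≈ _ p _ = sgn-zero (≈-trans (*-congʳ p) (zeroˡ l))
  ... | tri> _ _ p = sgn-pos (*-pos p 0<l)

  sgn-*-neg : ∀ x {l} → l < 0# → sgn (x * l) ≡ ℤ.- sgn x
  sgn-*-neg x {l} l<0 = trans (sgn-cong (≈-sym (-‿involutive (x * l)))) (trans (sgn-‿ (- (x * l)))
    (cong ℤ.-_ (trans (sgn-cong (-‿distribʳ-* x l)) (sgn-*-pos x (neg-neg l<0)))))

  -- With `N₀` the root of the affine function, `b + N * a` equals `a * (N - N₀)`, and the second
  -- factor is positive beyond the root whatever the sign of `a`.
  sgn-eventually : ∀ a b → ¬ (a ≈ 0#) → ∃ λ N₀ → ∀ N → N₀ < N → sgn (b + N * a) ≡ sgn a
  sgn-eventually a b a≉0 = N₀ , λ N N₀<N →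
      trans (sgn-cong (step N)) (sgn-*-pos a (<⇒0<- N₀<N))
    where
    a⁻¹ = proj₁ (inverse a a≉0)
    N₀ = - (b * a⁻¹)
    step : ∀ N → b + N * a ≈ a * (N - N₀)
    step N = begin
      b + N * a                   ≈⟨ +-comm b (N * a) ⟩
      N * a + b                   ≈⟨ +-cong (*-comm N a) (≈-sym (*-identityʳ b)) ⟩
      a * N + b * 1#              ≈⟨ +-congˡ (*-congˡ (≈-sym (proj₂ (inverse a a≉0)))) ⟩
      a * N + b * (a * a⁻¹)       ≈⟨ +-congˡ (≈-trans (≈-sym (*-assoc b a a⁻¹)) (≈-trans (*-congʳ (*-comm b a)) (*-assoc a b a⁻¹))) ⟩
      a * N + a * (b * a⁻¹)       ≈⟨ +-congˡ (*-congˡ (≈-sym (-‿involutive _))) ⟩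
      a * N + a * (- N₀)          ≈⟨ ≈-sym (distribˡ a N (- N₀)) ⟩
      a * (N - N₀)                ∎
      where open ≈-R

  upperBound : ∀ {a} {A : Set a} (g : A → Carrier) (xs : List A) → ∃ λ N → ∀ {x} → x ∈ xs → g x < N
  upperBound g []       = 0# , λ ()
  upperBound g (x ∷ xs) with N , N-ub ← upperBound g xs | compare N (g x)
  ... | tri> _ _ gx<N = N , λ { (here refl) → gx<N ; (there x∈) → N-ub x∈ }
  ... | tri≈ _ N≈gx _ = N + 1# , λ { (here refl) → <-respˡ N≈gx (x<x+1 N) ; (there x∈) → <-trans (N-ub x∈) (x<x+1 N) }
  ... | tri< N<gx _ _ = g x + 1# , λ { (here refl) → x<x+1 (g x) ; (there x∈) → <-trans (N-ub x∈) (<-trans N<gx (x<x+1 (g x))) }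

  *≈0⇒≈0 : ∀ {a b} → a * b ≈ 0# → ¬ (b ≈ 0#) → a ≈ 0#
  *≈0⇒≈0 {a} {b} ab≈0 b≉0 = begin
    a                ≈⟨ *-identityʳ a ⟨
    a * 1#           ≈⟨ *-congˡ (proj₂ (inverse b b≉0)) ⟨
    a * (b * b⁻¹)    ≈⟨ *-assoc a b b⁻¹ ⟨
    a * b * b⁻¹      ≈⟨ *-congʳ ab≈0 ⟩
    0# * b⁻¹         ≈⟨ zeroˡ b⁻¹ ⟩
    0#               ∎
    where
    open ≈-R
    b⁻¹ = proj₁ (inverse b b≉0)

  solveLinear : ∀ {a} b → ¬ (a ≈ 0#) → ∃ λ t → b + t * a ≈ 0#
  solveLinear {a} b a≉0 = - (b * a⁻¹) , (begin
    b + (- (b * a⁻¹)) * a     ≈⟨ +-congˡ (≈-sym (-‿distribˡ-* _ a)) ⟩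
    b - (b * a⁻¹) * a         ≈⟨ +-congˡ (-‿cong (≈-trans (*-assoc b a⁻¹ a) (*-congˡ (≈-trans (*-comm a⁻¹ a) (proj₂ (inverse a a≉0)))))) ⟩
    b - b * 1#                ≈⟨ +-congˡ (-‿cong (*-identityʳ b)) ⟩
    b - b                     ≈⟨ -‿inverseʳ b ⟩
    0#                        ∎)
    where
    open ≈-R
    a⁻¹ = proj₁ (inverse a a≉0)

  -- Vectors X are only accessed through the functionals Φ, so that Φ can be
  -- cut down to the functionals vanishing at a point without changing X.
  record Space (x φ : Level) : Set (c ⊔ ℓ₁ ⊔ lsuc (x ⊔ φ)) where
    field
      X       : Set x
      Φ       : Set φ
      ev      : Φ → X → Carrier
      lin     : Φ → Carrier → Φ → Φ
      ev-lin  : ∀ h t k v → ev (lin h t k) v ≈ ev h v + t * ev k v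
      zeroΦ   : Φ
      ev-zero : ∀ v → ev zeroΦ v ≈ 0#

    Kills : Φ → List X → Set (x ⊔ ℓ₁)
    Kills h S = All (λ s → ev h s ≈ 0#) S

    -- The double annihilator stands in for linear combinations, as `X` has no operations. `decSpan`
    -- makes it decidable and provides a separating functional otherwise.
    Span : List X → X → Set (x ⊔ φ ⊔ ℓ₁)
    Span S v = ∀ h → Kills h S → ev h v ≈ 0#

    field
      decSpan : ∀ S v → Span S v ⊎ ∃ λ h → Kills h S × ¬ (ev h v ≈ 0#)

-- Parity and integer inequalities.

Even Odd : ℕ → Set
Even n = ∃ λ k → n ≡ 2 ℕ.* k
Odd n = ∃ λ k → n ≡ suc (2 ℕ.* k)

¬even×odd : ∀ {n} → Even n → ¬ Odd n
¬even×odd (k , refl) (l , eq) = ℕₚ.even≢odd k l eq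

even⊎odd : ∀ n → Even n ⊎ Odd n
even⊎odd zero    = inj₁ (0 , refl)
even⊎odd (suc n) with even⊎odd n
... | inj₁ (k , refl) = inj₂ (k , refl)
... | inj₂ (k , refl) = inj₁ (suc k , sym (ℕₚ.*-suc 2 k))

odd-2*+ : ∀ k {n} → Odd n → Odd (2 ℕ.* k ℕ.+ n)
odd-2*+ k (l , refl) = k ℕ.+ l , trans (ℕₚ.+-suc (2 ℕ.* k) (2 ℕ.* l)) (cong suc (sym (ℕₚ.*-distribˡ-+ 2 k l)))

odd-+⁻ : ∀ {m n} → Even (m ℕ.+ n) → Odd m → Odd n
odd-+⁻ {m} {zero}        even odd        = contradiction (subst Odd (sym (ℕₚ.+-identityʳ m)) odd) (¬even×odd even)
odd-+⁻ {m} {suc zero}    _    _          = 0 , refl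
odd-+⁻ {m} {suc (suc n)} (k , eq) odd with k | trans (sym (trans (ℕₚ.+-suc m (suc n)) (cong suc (ℕₚ.+-suc m n)))) eq
... | suc k′ | eq′ = let l , e = odd-+⁻ {m} {n} (k′ , ℕₚ.suc-injective (ℕₚ.suc-injective (trans eq′ (ℕₚ.*-suc 2 k′)))) odd
                     in suc l , trans (cong (λ i → suc (suc i)) e) (cong suc (sym (ℕₚ.*-suc 2 l)))

+≤⇒≤ : ∀ {a b c} → a ℤ.+ b ℤ.≤ c → 0ℤ ℤ.≤ a → b ℤ.≤ c
+≤⇒≤ {a} {b} {c} ab≤c 0≤a = ℤₚ.≤-trans (subst (ℤ._≤ a ℤ.+ b) (ℤₚ.+-identityˡ b) (ℤₚ.+-monoˡ-≤ b 0≤a)) ab≤c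

ℤ-+-cancelˡ-≤ : ∀ s {a b} → s ℤ.+ a ℤ.≤ s ℤ.+ b → a ℤ.≤ b
ℤ-+-cancelˡ-≤ s {a} {b} le = subst₂ ℤ._≤_ (cancel a) (cancel b) (ℤₚ.+-monoʳ-≤ (ℤ.- s) le)
  where
  cancel : ∀ u → ℤ.- s ℤ.+ (s ℤ.+ u) ≡ u
  cancel u = trans (sym (ℤₚ.+-assoc (ℤ.- s) s u)) (trans (cong (ℤ._+ u) (ℤₚ.+-inverseˡ s)) (ℤₚ.+-identityˡ u))

+≤⇒≤-1 : ∀ {a b} D → a ℤ.+ b ℤ.≤ + suc D → 1ℤ ℤ.≤ a → b ℤ.≤ + D
+≤⇒≤-1 {a} {b} D ab≤ 1≤a = ℤ-+-cancelˡ-≤ 1ℤ (ℤₚ.≤-trans (ℤₚ.+-monoˡ-≤ b 1≤a) ab≤)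

0≤∧≢0⇒1≤ : ∀ {a} → 0ℤ ℤ.≤ a → a ≢ 0ℤ → 1ℤ ℤ.≤ a
0≤∧≢0⇒1≤ {+ zero}  _ a≢0 = contradiction refl a≢0
0≤∧≢0⇒1≤ {+ suc n} _ _   = +≤+ (s≤s z≤n)

≤2∧≢2⇒≤1 : ∀ {a} → a ℤ.≤ + 2 → a ≢ + 2 → a ℤ.≤ 1ℤ
≤2∧≢2⇒≤1 { -[1+ n ]}           _                      _   = -≤+
≤2∧≢2⇒≤1 {+ zero}              _                      _   = +≤+ z≤n
≤2∧≢2⇒≤1 {+ suc zero}          _                      _   = +≤+ (s≤s z≤n)
≤2∧≢2⇒≤1 {+ suc (suc zero)}    _                      ≢2 = contradiction refl ≢2
≤2∧≢2⇒≤1 {+ suc (suc (suc n))} (+≤+ (s≤s (s≤s ())))   _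

1≤∧≢1⇒2≤ : ∀ {a} → 1ℤ ℤ.≤ a → a ≢ 1ℤ → + 2 ℤ.≤ a
1≤∧≢1⇒2≤ {+ zero}        (+≤+ ()) _
1≤∧≢1⇒2≤ {+ suc zero}    _        ≢1 = contradiction refl ≢1
1≤∧≢1⇒2≤ {+ suc (suc n)} _        _  = +≤+ (s≤s (s≤s z≤n))

∈⇒1≤length : ∀ {a} {A : Set a} {x : A} {xs} → x ∈ xs → 1 ℕ.≤ length xs
∈⇒1≤length (here _)  = s≤s z≤n
∈⇒1≤length (there _) = s≤s z≤n

++[]⊆ : ∀ {a} {A : Set a} (S : List A) {s} → s ∈ S ++ [] → s ∈ S
++[]⊆ S s∈ with ∈-++⁻ S s∈
... | inj₁ s∈S = s∈S

-- Spans, exchange, generic perturbation and the discrepancy of a functional.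

module Configurations {c ℓ₁ ℓ₂} (F : OrderedField c ℓ₁ ℓ₂) {x φ : Level} (𝒮 : Sign.Space F x φ) where
  open Sign F
  open Space 𝒮

  lin-zero : ∀ {h t k v} → ev h v ≈ 0# → ev k v ≈ 0# → ev (lin h t k) v ≈ 0#
  lin-zero {h} {t} {k} {v} hv kv = ≈-trans (ev-lin h t k v) (≈-trans (+-cong hv (≈-trans (*-congˡ kv) (zeroʳ t))) (+-identityˡ 0#))

  lin-kills : ∀ {h t k S} → Kills h S → Kills k S → Kills (lin h t k) S
  lin-kills hS kS = All.zipWith (λ (hv , kv) → lin-zero hv kv) (hS , kS)

  opaque
    span? : ∀ S v → Dec (Span S v)
    span? S v with decSpan S v
    ... | inj₁ sp             = yes sp
    ... | inj₂ (h , hS , hv) = no λ sp → hv (sp h hS)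

  separate : ∀ {S v} → ¬ Span S v → ∃ λ h → Kills h S × ¬ (ev h v ≈ 0#)
  separate {S} {v} ¬sp with decSpan S v
  ... | inj₁ sp = contradiction sp ¬sp
  ... | inj₂ r  = r

  span-∈ : ∀ {S v} → v ∈ S → Span S v
  span-∈ v∈S h hS = All.lookup hS v∈S

  span-mono : ∀ {S S′ v} → (∀ {s} → s ∈ S → Span S′ s) → Span S v → Span S′ v
  span-mono sub sp h hS′ = sp h (All.tabulate (λ s∈ → sub s∈ h hS′))

  span-⊆ : ∀ {S S′ v} → (∀ {s} → s ∈ S → s ∈ S′) → Span S v → Span S′ v
  span-⊆ sub = span-mono (λ s∈ → span-∈ (sub s∈))

  span-∷⁺ : ∀ {s S S′ v} → Span S′ s → (∀ {t} → t ∈ S → Span S′ t) → Span (s ∷ S) v → Span S′ v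
  span-∷⁺ s⊂ S⊂ = span-mono λ { (here refl) → s⊂ ; (there s∈) → S⊂ s∈ }

  span-weaken : ∀ {s S v} → Span S v → Span (s ∷ S) v
  span-weaken = span-⊆ there

  span-swap : ∀ {s t v} → Span (s ∷ t ∷ []) v → Span (t ∷ s ∷ []) v
  span-swap = span-⊆ λ { (here e) → there (here e) ; (there (here e)) → here e }

  -- Given `h` killing `r` and `S`, correct it by a multiple `t` of a functional `k` that kills `S`
  -- but not `r`, so that the sum kills `y`. Then it kills `r` as well, which forces `t` to vanish,
  -- so `h` itself kills `y`.
  exchange : ∀ {S r y} → Span (y ∷ S) r → ¬ Span S r → Span (r ∷ S) y
  exchange {S} {r} {y} sp ¬sp h (hr ∷ hS) with k , kS , kr≉0 ← separate ¬sp = hy≈0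
    where
    ky≉0 : ¬ (ev k y ≈ 0#)
    ky≉0 ky≈0 = kr≉0 (sp k (ky≈0 ∷ kS))
    t = proj₁ (solveLinear (ev h y) ky≉0)
    h′ = lin h t k
    h′y≈0 : ev h y + t * ev k y ≈ 0#
    h′y≈0 = proj₂ (solveLinear (ev h y) ky≉0)
    h′r≈0 : ev h r + t * ev k r ≈ 0#
    h′r≈0 = ≈-trans (≈-sym (ev-lin h t k r)) (sp h′ (≈-trans (ev-lin h t k y) h′y≈0 ∷ lin-kills hS kS))
    t≈0 : t ≈ 0#
    t≈0 = *≈0⇒≈0 (≈-trans (≈-sym (≈-trans (+-congʳ hr) (+-identityˡ _))) h′r≈0) kr≉0
    hy≈0 : ev h y ≈ 0#
    hy≈0 = ≈-trans (≈-sym (≈-trans (+-congˡ (≈-trans (*-congʳ t≈0) (zeroˡ _))) (+-identityʳ _))) h′y≈0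

  -- Linear independence of `T` modulo `B` without coefficients: every element avoids the span of
  -- `B` and its predecessors.
  Chain : List X → List X → Set (x ⊔ φ ⊔ ℓ₁)
  Chain B []      = ⊤
  Chain B (t ∷ T) = ¬ Span B t × Chain (t ∷ B) T

  -- Drops the first `s` without which `t` is no longer spanned; by `exchange`, `t` recovers it.
  span-replace : ∀ S {B t} → Span (S ++ B) t → ¬ Span B t →
    ∃ λ S′ → length S ≡ suc (length S′) × (∀ {v} → Span (S ++ B) v → Span (S′ ++ t ∷ B) v)
  span-replace []      sp ¬sp = contradiction sp ¬sp
  span-replace (s ∷ S) {B} {t} sp ¬sp with span? (S ++ B) t
  ... | yes spS with S′ , len , sub ← span-replace S spS ¬sp =
    s ∷ S′ , cong suc len , span-∷⁺ (span-∈ (here refl)) (λ s∈ → span-weaken (sub (span-∈ s∈)))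
  ... | no ¬spS = S , refl ,
      span-∷⁺ (span-⊆ move (exchange sp ¬spS)) (λ s∈ → span-⊆ (λ u∈ → move (there u∈)) (span-∈ s∈))
    where
    move : ∀ {u} → u ∈ t ∷ S ++ B → u ∈ S ++ t ∷ B
    move (here e)  = ∈-++⁺ʳ S (here e)
    move (there u∈) with ∈-++⁻ S u∈
    ... | inj₁ u∈S = ∈-++⁺ˡ u∈S
    ... | inj₂ u∈B = ∈-++⁺ʳ S (there u∈B)

  steinitz : ∀ T S {B} → Chain B T → (∀ {t} → t ∈ T → Span (S ++ B) t) → length T ℕ.≤ length S
  steinitz []      S _          _   = z≤n
  steinitz (t ∷ T) S (¬sp , ch) sub with S′ , len , sub′ ← span-replace S (sub (here refl)) ¬sp =
    subst (suc (length T) ℕ.≤_) (sym len) (s≤s (steinitz T S′ ch (λ t∈ → sub′ (sub (there t∈)))))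

  ∃∉span : ∀ S U → (∀ {u} → u ∈ U → Span S u) ⊎ ∃ λ u → u ∈ U × ¬ Span S u
  ∃∉span S U with all? (span? S) U
  ... | yes all = inj₁ (All.lookup all)
  ... | no ¬all = inj₂ (find (¬All⇒Any¬ (span? S) U ¬all))

  opaque
    -- Greedy choice of elements outside the span so far, stopped after `suc n` of them.
    basis : ∀ n U B → (∃ λ S → length S ℕ.≤ n × (∀ {u} → u ∈ U → Span (S ++ B) u)) ⊎
                       (∃ λ T → length T ≡ suc n × All (_∈ U) T × Chain B T)
    basis n U B with ∃∉span B U
    ... | inj₁ all = inj₁ ([] , z≤n , all)
    basis zero    U B | inj₂ (u , u∈ , ¬sp) = inj₂ (u ∷ [] , refl , u∈ ∷ [] , ¬sp , tt)
    basis (suc n) U B | inj₂ (u , u∈ , ¬sp) with basis n U (u ∷ B)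
    ... | inj₁ (S , len , all) = inj₁ (u ∷ S , s≤s len , λ v∈ → span-⊆ move (all v∈))
      where
      move : ∀ {v} → v ∈ S ++ u ∷ B → v ∈ u ∷ S ++ B
      move v∈ with ∈-++⁻ S v∈
      ... | inj₁ v∈S         = there (∈-++⁺ˡ v∈S)
      ... | inj₂ (here e)    = here e
      ... | inj₂ (there v∈B) = there (∈-++⁺ʳ S v∈B)
    ... | inj₂ (T , len , T⊆ , ch) = inj₂ (u ∷ T , cong suc len , u∈ ∷ T⊆ , ¬sp , ch)

  neg : Φ → Φ
  neg = lin zeroΦ (- 1#)

  ev-neg : ∀ h v → ev (neg h) v ≈ - ev h v
  ev-neg h v = ≈-trans (ev-lin zeroΦ (- 1#) h v) (≈-trans (+-cong (ev-zero v) (-1*x≈-x _)) (+-identityˡ _))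

  zero-kills : ∀ S → Kills zeroΦ S
  zero-kills S = All.tabulate (λ {s} _ → ev-zero s)

  neg-zero : ∀ {h v} → ev h v ≈ 0# → ev (neg h) v ≈ 0#
  neg-zero = lin-zero (ev-zero _)

  neg-zero⁻¹ : ∀ {h v} → ev (neg h) v ≈ 0# → ev h v ≈ 0#
  neg-zero⁻¹ {h} {v} e = ≈-trans (≈-sym (-‿involutive _)) (≈-trans (-‿cong (≈-trans (≈-sym (ev-neg h v)) e)) -0#≈0#)

  separate⁺ : ∀ {S v} → ¬ Span S v → ∃ λ h → Kills h S × 0# < ev h v
  separate⁺ {S} {v} ¬sp with h , hS , hv ← separate ¬sp | compare (ev h v) 0#
  ... | tri< p _ _ = neg h , All.map neg-zero hS , <-respʳ (≈-sym (ev-neg h v)) (neg-neg p)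
  ... | tri≈ _ p _ = contradiction p hv
  ... | tri> _ _ p = h , hS , p

  -- The functional `h` plus an infinitesimal multiple of `g`, as far as the finite list `Y` can
  -- tell.
  record _▹_On_ (h g : Φ) (Y : List X) : Set (x ⊔ φ ⊔ ℓ₁) where
    field
      fun     : Φ
      kills   : ∀ {v} → ev h v ≈ 0# → ev g v ≈ 0# → ev fun v ≈ 0#
      sgn-fst : ∀ {y} → y ∈ Y → ¬ (ev h y ≈ 0#) → sgn (ev fun y) ≡ sgn (ev h y)
      sgn-snd : ∀ {y} → ev h y ≈ 0# → sgn (ev fun y) ≡ sgn (ev g y)

  opaque
    compose : ∀ h g Y → h ▹ g On Y
    compose h g Y = record
      -- Instead of shrinking `g`, `h` is enlarged: `N` exceeds the finitely many thresholds beyond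
      -- which `g + N * h` has the sign of `h`.
      { fun     = lin g N h
      ; kills   = λ hv gv → lin-zero gv hv
      ; sgn-fst = λ y∈ hy≉0 → trans (sgn-cong (ev-lin g N h _)) (large y∈ hy≉0)
      ; sgn-snd = λ {y} hy≈0 → sgn-cong (≈-trans (ev-lin g N h y) (≈-trans (+-congˡ (≈-trans (*-congˡ hy≈0) (zeroʳ N))) (+-identityʳ _)))
      }
      where
      bound : X → Carrier
      bound y with zero? (ev h y)
      ... | yes _   = 0#
      ... | no hy≉0 = proj₁ (sgn-eventually (ev h y) (ev g y) hy≉0)
      N : Carrier
      N = proj₁ (upperBound bound Y)
      large : ∀ {y} → y ∈ Y → ¬ (ev h y ≈ 0#) → sgn (ev g y + N * ev h y) ≡ sgn (ev h y)
      large {y} y∈ hy≉0 with zero? (ev h y) | proj₂ (upperBound bound Y) y∈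
      ... | yes hy≈0 | _   = contradiction hy≈0 hy≉0
      ... | no hy≉0′ | b<N = proj₂ (sgn-eventually (ev h y) (ev g y) hy≉0′) N b<N

  sgn-nonzero : ∀ {a b} → sgn a ≡ sgn b → ¬ (b ≈ 0#) → ¬ (a ≈ 0#)
  sgn-nonzero eq b≉0 a≈0 = b≉0 (sgn-zero⁻¹ (trans (sym eq) (sgn-zero a≈0)))

  ▹-nonzero : ∀ {h g Y y} (k : h ▹ g On Y) → y ∈ Y → (ev h y ≈ 0# → ¬ (ev g y ≈ 0#)) → ¬ (ev (_▹_On_.fun k) y ≈ 0#)
  ▹-nonzero {h} {y = y} k y∈ g≉0 with zero? (ev h y)
  ... | yes hy≈0 = sgn-nonzero (_▹_On_.sgn-snd k hy≈0) (g≉0 hy≈0)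
  ... | no hy≉0  = sgn-nonzero (_▹_On_.sgn-fst k y∈ hy≉0) hy≉0

  opaque
    -- Treats the elements of `V` one at a time; a perturbation by a functional nonzero at the new
    -- element spoils none of the others.
    generic : ∀ S V → ∃ λ h → Kills h S × (∀ {v} → v ∈ V → ¬ Span S v → ¬ (ev h v ≈ 0#))
    generic S []      = zeroΦ , zero-kills S , λ ()
    generic S (v ∷ V) with h , hS , hV ← generic S V | decSpan S v
    ... | inj₁ sp = h , hS , λ { (here refl) ¬sp _ → ¬sp sp ; (there u∈) → hV u∈ }
    ... | inj₂ (g , gS , gv≉0) = fun , All.zipWith (λ (a , b) → kills a b) (hS , gS) , nonzero
      where
      open _▹_On_ (compose h g (v ∷ V))
      nonzero : ∀ {u} → u ∈ v ∷ V → ¬ Span S u → ¬ (ev fun u ≈ 0#)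
      nonzero (there u∈) ¬sp = ▹-nonzero (compose h g (v ∷ V)) (there u∈) (λ hu≈0 → contradiction hu≈0 (hV u∈ ¬sp))
      nonzero (here refl) _  = ▹-nonzero (compose h g (v ∷ V)) (here refl) (λ _ → gv≉0)

  zeros : Φ → List X → List X
  zeros h = filter (λ y → zero? (ev h y))

  flat : List X → List X → List X
  flat S = filter (span? S)

  disc : List X → Φ → ℤ
  disc Y h = sumBy (λ y → sgn (ev h y)) Y

  -- The zero functional is included; its discrepancy is 0, so for a natural number `D` this is
  -- harmless.
  record DiscLe (D : ℕ) (Y : List X) : Set φ where
    field
      disc≤ : ∀ h → disc Y h ℤ.≤ + D
  open DiscLe public

  disc-neg : ∀ Y h → disc Y (neg h) ≡ ℤ.- disc Y h
  disc-neg Y h = trans (sumBy-cong Y (λ {y} _ → trans (sgn-cong (ev-neg h y)) (sgn-‿ (ev h y)))) (sumBy-neg _ Y)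

  -- Zeros of `h` contribute nothing to `disc Y h` and take the sign of `g` after the perturbation;
  -- all other signs are kept.
  disc-compose : ∀ {Y h g} (k : h ▹ g On Y) → disc Y (_▹_On_.fun k) ≡ disc Y h ℤ.+ disc (zeros h Y) g
  disc-compose {Y} {h} {g} k = begin
    disc Y fun                                       ≡⟨ sumBy-filter (λ y → zero? (ev h y)) _ Y ⟩
    disc (zeros h Y) fun ℤ.+ disc nonzeros fun       ≡⟨ cong₂ ℤ._+_
                                                          (sumBy-cong (zeros h Y) (λ y∈ → sgn-snd (proj₂ (∈-filter⁻ (λ y → zero? (ev h y)) {xs = Y} y∈))))
                                                          (sumBy-cong nonzeros (λ y∈ → let y∈Y , hy = ∈-filter⁻ (λ y → ¬? (zero? (ev h y))) y∈ in sgn-fst y∈Y hy)) ⟩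
    disc (zeros h Y) g ℤ.+ disc nonzeros h           ≡⟨ ℤₚ.+-comm (disc (zeros h Y) g) _ ⟩
    disc nonzeros h ℤ.+ disc (zeros h Y) g           ≡⟨ cong (ℤ._+ disc (zeros h Y) g) disc-h ⟨
    disc Y h ℤ.+ disc (zeros h Y) g                  ∎
    where
    open ≡-Reasoning
    open _▹_On_ k
    nonzeros = filter (λ y → ¬? (zero? (ev h y))) Y
    disc-h : disc Y h ≡ disc nonzeros h
    disc-h = trans (sumBy-filter (λ y → zero? (ev h y)) _ Y) (trans (cong (ℤ._+ disc nonzeros h)
      (sumBy-0 (zeros h Y) (λ y∈ → sgn-zero (proj₂ (∈-filter⁻ (λ y → zero? (ev h y)) {xs = Y} y∈))))) (ℤₚ.+-identityˡ _))

  disc-local : ∀ {D Y} → DiscLe D Y → ∀ h g → disc Y h ℤ.+ disc (zeros h Y) g ℤ.≤ + D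
  disc-local {D} {Y} le h g = subst (ℤ._≤ + D) (disc-compose (compose h g Y)) (disc≤ le _)

  opaque
    -- Here `n` counts the elements on which `h` is negative. The use is parity: the length is
    -- congruent to the discrepancy plus the number of zeros.
    length-disc : ∀ Y h → ∃ λ n → + length Y ≡ disc Y h ℤ.+ (+ (2 ℕ.* n ℕ.+ length (zeros h Y)))
    length-disc []      h = 0 , refl
    length-disc (y ∷ Y) h with n , eq ← length-disc Y h | zero? (ev h y)
    ... | yes hy≈0 = n , trans (cong (λ l → 1ℤ ℤ.+ l) eq)
          (trans (solve 3 (λ s a b → con 1ℤ :+ (s :+ (a :+ b)) := con 0ℤ :+ s :+ (a :+ (con 1ℤ :+ b))) refl
                   (disc Y h) (+ (2 ℕ.* n)) (+ length (zeros h Y)))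
            (cong (λ s → s ℤ.+ disc Y h ℤ.+ (+ (2 ℕ.* n) ℤ.+ + suc (length (zeros h Y)))) (sym (sgn-zero hy≈0))))
      where open ℤ-Solver
    ... | no hy≉0 with compare (ev h y) 0#
    ...   | tri< _ _ _ = suc n , trans (cong (λ l → 1ℤ ℤ.+ l) eq)
            (trans (solve 3 (λ s a b → con 1ℤ :+ (s :+ (a :+ b)) := con -1ℤ :+ s :+ ((con (+ 2) :+ a) :+ b)) refl
                   (disc Y h) (+ (2 ℕ.* n)) (+ length (zeros h Y)))
              (cong (λ m → -1ℤ ℤ.+ disc Y h ℤ.+ (+ (m ℕ.+ length (zeros h Y)))) (sym (ℕₚ.*-suc 2 n))))
      where open ℤ-Solver
    ...   | tri≈ _ p _ = contradiction p hy≉0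
    ...   | tri> _ _ _ = n , trans (cong (λ l → 1ℤ ℤ.+ l) eq) (sym (ℤₚ.+-assoc 1ℤ (disc Y h) _))

  opaque
    wlog-nonneg : ∀ Y h → ∃ λ h′ → 0ℤ ℤ.≤ disc Y h′ × (∀ {v} → ev h v ≈ 0# → ev h′ v ≈ 0#) × (∀ {v} → ev h′ v ≈ 0# → ev h v ≈ 0#)
    wlog-nonneg Y h with ℤₚ.≤-total 0ℤ (disc Y h)
    ... | inj₁ 0≤ = h , 0≤ , (λ e → e) , (λ e → e)
    ... | inj₂ ≤0 = neg h , subst (0ℤ ℤ.≤_) (sym (disc-neg Y h)) (ℤₚ.neg-mono-≤ ≤0) , neg-zero , neg-zero⁻¹

  -- Parallel and antiparallel, expressed by signs alone; in a quotient space this becomes the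
  -- relation modulo a point.
  Same Opp : X → X → Set (φ)
  Same y z = ∀ h → sgn (ev h z) ≡ sgn (ev h y)
  Opp y z  = ∀ h → sgn (ev h z) ≡ ℤ.- sgn (ev h y)

  opp-sym : ∀ {y z} → Opp y z → Opp z y
  opp-sym o h = trans (sym (ℤₚ.neg-involutive _)) (cong ℤ.-_ (sym (o h)))


  -- The ratio is `ev g z` over `ev g y` for one `g` nonzero at `z`. For any `h`, the combination of
  -- `h` and `g` that kills `y` also kills `z`, which gives the same ratio.
  proportional : ∀ {y z} → Span [ y ] z → ¬ Span [] z → ∃ λ l → ¬ (l ≈ 0#) × (∀ h → ev h z ≈ ev h y * l)
  proportional {y} {z} sp z≢0 with g , _ , gz≉0 ← separate z≢0 = l , l≉0 , prop
    where
    gy≉0 : ¬ (ev g y ≈ 0#)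
    gy≉0 e = gz≉0 (sp g (e ∷ []))
    i = proj₁ (inverse _ gy≉0)
    l = ev g z * i
    prop : ∀ h → ev h z ≈ ev h y * l
    prop h with t , eq ← solveLinear (ev h y) gy≉0 = begin
      ev h z                               ≈⟨ +-inverseˡ-unique _ _ (≈-trans (≈-sym (ev-lin h t g z)) (sp _ (≈-trans (ev-lin h t g y) eq ∷ []))) ⟩
      - (t * ev g z)                       ≈⟨ -‿cong (*-identityʳ _) ⟨
      - (t * ev g z * 1#)                  ≈⟨ -‿cong (*-congˡ (proj₂ (inverse _ gy≉0))) ⟨
      - (t * ev g z * (ev g y * i))        ≈⟨ -‿cong swap-middle ⟩
      - (t * ev g y * (ev g z * i))        ≈⟨ -‿distribˡ-* _ _ ⟩
      - (t * ev g y) * l                   ≈⟨ *-congʳ (+-inverseˡ-unique _ _ eq) ⟨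
      ev h y * l                           ∎
      where
      open ≈-R
      swap-middle : t * ev g z * (ev g y * i) ≈ t * ev g y * (ev g z * i)
      swap-middle = ≈-trans (*-assoc t _ _) (≈-trans (*-congˡ (x∙yz≈y∙xz (ev g z) (ev g y) i)) (≈-sym (*-assoc t _ _)))
    l≉0 : ¬ (l ≈ 0#)
    l≉0 l≈0 = gz≉0 (≈-trans (prop g) (≈-trans (*-congˡ l≈0) (zeroʳ _)))

  parallel : ∀ {y z} → Span [ y ] z → ¬ Span [] z → Same y z ⊎ Opp y z
  parallel {y} sp z≢0 with l , l≉0 , prop ← proportional sp z≢0 | compare l 0#
  ... | tri< l<0 _ _ = inj₂ λ h → trans (sgn-cong (prop h)) (sgn-*-neg (ev h y) l<0)
  ... | tri≈ _ l≈0 _ = contradiction l≈0 l≉0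
  ... | tri> _ _ 0<l = inj₁ λ h → trans (sgn-cong (prop h)) (sgn-*-pos (ev h y) 0<l)

  -- The dual of the quotient by `p` is the annihilator of `p`; a span in the quotient is the span
  -- with `p` adjoined.
  quotient : X → Sign.Space F x (φ ⊔ ℓ₁)
  quotient p = record
    { X       = X
    ; Φ       = Σ Φ λ h → ev h p ≈ 0#
    ; ev      = λ (h , _) → ev h
    ; lin     = λ (h , hp) t (k , kp) → lin h t k , lin-zero hp kp
    ; ev-lin  = λ (h , _) t (k , _) → ev-lin h t k
    ; zeroΦ   = zeroΦ , ev-zero p
    ; ev-zero = ev-zero
    ; decSpan = dec
    }
    where
    dec : ∀ S v → (∀ (h : Σ Φ λ h → ev h p ≈ 0#) → Kills (proj₁ h) S → ev (proj₁ h) v ≈ 0#) ⊎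
                  ∃ λ (h : Σ Φ λ h → ev h p ≈ 0#) → Kills (proj₁ h) S × ¬ (ev (proj₁ h) v ≈ 0#)
    dec S v with decSpan (p ∷ S) v
    ... | inj₁ sp                  = inj₁ λ (h , hp) hS → sp h (hp ∷ hS)
    ... | inj₂ (h , hp ∷ hS , hv) = inj₂ ((h , hp) , hS , hv)

-- Reduced families: flats, lines through a point, and rank at most 2 when the discrepancy is at
-- most 1.

module Discrepancy {c ℓ₁ ℓ₂} (F : OrderedField c ℓ₁ ℓ₂) {x φ : Level} (𝒮 : Sign.Space F x φ) where
  open Sign F
  open Space 𝒮
  open Configurations F 𝒮

  -- The case of equal `y` and `z` is included and excludes zero vectors, which are opposite to
  -- themselves.
  Reduced : List X → Set (x ⊔ φ)
  Reduced Y = ∀ {y z} → y ∈ Y → z ∈ Y → ¬ Opp y z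

  reduced-⊆ : ∀ {Y Z} → (∀ {y} → y ∈ Z → y ∈ Y) → Reduced Y → Reduced Z
  reduced-⊆ sub red y∈ z∈ = red (sub y∈) (sub z∈)

  reduced-filter : ∀ {p} {P : Pred X p} (P? : Decidable P) {Y} → Reduced Y → Reduced (filter P? Y)
  reduced-filter P? {Y} = reduced-⊆ (λ y∈ → proj₁ (∈-filter⁻ P? {xs = Y} y∈))

  reduced⇒nonzero : ∀ {Y y} → Reduced Y → y ∈ Y → ¬ Span [] y
  reduced⇒nonzero {y = y} red y∈ sp = red y∈ y∈ λ h → trans (sgn-zero (sp h [])) (cong ℤ.-_ (sym (sgn-zero (sp h []))))

  parallel-same : ∀ {Y y z} → Reduced Y → y ∈ Y → z ∈ Y → Span [ y ] z → Same y z
  parallel-same red y∈ z∈ sp with parallel sp (reduced⇒nonzero red z∈)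
  ... | inj₁ same = same
  ... | inj₂ opp  = contradiction opp (red y∈ z∈)

  disc-parallel : ∀ {Y y g} → Reduced Y → y ∈ Y → (∀ {z} → z ∈ Y → Span [ y ] z) → 0# < ev g y → disc Y g ≡ + length Y
  disc-parallel {Y} {g = g} red y∈ par 0<gy = sumBy-1 Y λ z∈ → trans (parallel-same red y∈ z∈ (par z∈) g) (sgn-pos 0<gy)

  -- Crossing the hyperplane of y generically changes disc by twice the size of
  -- the class of y, so disc cannot vanish on both sides.
  opaque
    disc-positive : ∀ {Y y} → Reduced Y → y ∈ Y → ∃ λ g → 1ℤ ℤ.≤ disc Y g × (∀ {z} → z ∈ Y → ¬ (ev g z ≈ 0#))
    disc-positive {Y} {y} red y∈
      with h₀ , hy ∷ [] , gen ← generic [ y ] Y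
      with h , 0≤ , to , from ← wlog-nonneg Y h₀
      with g , _ , 0<gy ← separate⁺ {[]} (reduced⇒nonzero red y∈) = fun , 1≤ , nonzero
      where
      open _▹_On_ (compose h g Y)
      Z : List X
      Z = zeros h Y
      redZ : Reduced Z
      redZ = reduced-filter (λ z → zero? (ev h z)) red
      y∈Z : y ∈ Z
      y∈Z = ∈-filter⁺ (λ z → zero? (ev h z)) y∈ (to hy)
      par : ∀ {z} → z ∈ Y → ev h z ≈ 0# → Span [ y ] z
      par {z} z∈ hz with span? [ y ] z
      ... | yes sp = sp
      ... | no ¬sp = contradiction (from hz) (gen z∈ ¬sp)
      parZ : ∀ {z} → z ∈ Z → Span [ y ] z
      parZ z∈ = let z∈Y , hz = ∈-filter⁻ (λ z → zero? (ev h z)) {xs = Y} z∈ in par z∈Y hz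
      -- Once `disc Y h` is nonnegative, tilting towards `g` moves the whole class `Z` of `y` to the
      -- positive side and adds its size.
      1≤ : 1ℤ ℤ.≤ disc Y fun
      1≤ = begin
        0ℤ ℤ.+ 1ℤ                  ≤⟨ ℤₚ.+-mono-≤ 0≤ (+≤+ (∈⇒1≤length y∈Z)) ⟩
        disc Y h ℤ.+ + length Z    ≡⟨ cong (λ s → disc Y h ℤ.+ s) (disc-parallel redZ y∈Z parZ 0<gy) ⟨
        disc Y h ℤ.+ disc Z g      ≡⟨ disc-compose (compose h g Y) ⟨
        disc Y fun                 ∎
        where open ℤₚ.≤-Reasoning
      nonzero : ∀ {z} → z ∈ Y → ¬ (ev fun z ≈ 0#)
      nonzero z∈ = ▹-nonzero (compose h g Y) z∈ λ hz≈0 → sgn-nonzero (parallel-same red y∈ z∈ (par z∈ hz≈0) g)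
        (λ gy≈0 → <-irrefl (≈-sym gy≈0) 0<gy)

  -- The zeros of `h` form a nonempty reduced family, so some `g` has discrepancy at least 1 on
  -- them; perturbing `h` by this `g` uses up one unit of the bound.
  disc-zero-≤ : ∀ {D Y y h} → Reduced Y → DiscLe (suc D) Y → y ∈ Y → ev h y ≈ 0# → disc Y h ℤ.≤ + D
  disc-zero-≤ {D} {Y} {y} {h} red le y∈ hy
    with g , 1≤ , _ ← disc-positive (reduced-filter (λ z → zero? (ev h z)) red) (∈-filter⁺ (λ z → zero? (ev h z)) y∈ hy) =
    +≤⇒≤-1 D (subst (ℤ._≤ + suc D) (ℤₚ.+-comm (disc Y h) _) (disc-local le h g)) 1≤

  -- The preceding bound, now 0, holds for `h` and for its negative.
  disc-zero-≡ : ∀ {Y y h} → Reduced Y → DiscLe 1 Y → y ∈ Y → ev h y ≈ 0# → disc Y h ≡ 0ℤ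
  disc-zero-≡ {Y} {y} {h} red le y∈ hy = ℤₚ.≤-antisym (disc-zero-≤ red le y∈ hy)
    (subst (0ℤ ℤ.≤_) (ℤₚ.neg-involutive _) (ℤₚ.neg-mono-≤ (subst (ℤ._≤ 0ℤ) (disc-neg Y h) (disc-zero-≤ red le y∈ (neg-zero hy)))))

  -- Makes every flat of `U` the zero set of a functional of nonnegative discrepancy, so that
  -- `disc-local` applies to flats.
  flat-witness : ∀ S U → ∃ λ h → 0ℤ ℤ.≤ disc U h × zeros h U ≡ flat S U
  flat-witness S U with h₀ , hS , gen ← generic S U with h , 0≤ , to , from ← wlog-nonneg U h₀ =
    h , 0≤ , filter-cong-∈ (λ y → zero? (ev h y)) (span? S) U in-span (λ _ sp → to (sp h₀ hS))
    where
    in-span : ∀ {u} → u ∈ U → ev h u ≈ 0# → Span S u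
    in-span {u} u∈ hu with span? S u
    ... | yes sp = sp
    ... | no ¬sp = contradiction (from hu) (gen u∈ ¬sp)

  disc-flat : ∀ {D U} S → DiscLe D U → DiscLe D (flat S U)
  disc-flat {D} {U} S le .disc≤ g with h , 0≤ , eq ← flat-witness S U =
    +≤⇒≤ (subst (λ Z → disc U h ℤ.+ disc Z g ℤ.≤ + D) eq (disc-local le h g)) 0≤

  -- By parity the witness of an odd flat in an even family cannot have discrepancy 0, so at most
  -- one unit is left for the flat.
  disc-flat-odd : ∀ {U} S → DiscLe 2 U → Even (length U) → Odd (length (flat S U)) → DiscLe 1 (flat S U)
  disc-flat-odd {U} S le even odd .disc≤ g with h , 0≤ , eq ← flat-witness S U =
    +≤⇒≤-1 1 (subst (λ Z → disc U h ℤ.+ disc Z g ℤ.≤ + 2) eq (disc-local le h g)) (0≤∧≢0⇒1≤ 0≤ disc≢0)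
    where
    disc≢0 : disc U h ≢ 0ℤ
    disc≢0 e with n , len ← length-disc U h = ¬even×odd even (subst Odd (sym len′) (odd-2*+ n odd))
      where
      len′ : length U ≡ 2 ℕ.* n ℕ.+ length (flat S U)
      len′ = ℤₚ.+-injective (trans len (trans (cong (ℤ._+ + (2 ℕ.* n ℕ.+ length (zeros h U))) e)
               (trans (ℤₚ.+-identityˡ _) (cong (λ Z → + (2 ℕ.* n ℕ.+ length Z)) eq))))

  -- The elements outside G are grouped by the lines through c; such a line meets G
  -- only in the class of c.
  disc-lines : ∀ U G c h ts → Span G c →
    (∀ {y} → y ∈ U → ¬ Span G y → disc (flat (y ∷ c ∷ []) U) h ℤ.≤ disc (flat [ c ] U) h) →
    All (λ t → t ∈ U × ¬ Span G t × disc (flat (t ∷ c ∷ []) U) h ℤ.≤ disc (flat [ c ] U) h ℤ.+ -1ℤ) ts →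
    AllPairs (λ t t′ → ¬ Span (t ∷ c ∷ []) t′) ts →
    disc U h ℤ.≤ disc (flat G U) h ℤ.+ (ℤ.- (+ length ts))
  disc-lines U G c h ts c∈G line≤ ts≤ ts≁ = begin
    disc U h                                      ≡⟨ sumBy-filter (span? G) w U ⟩
    disc (flat G U) h ℤ.+ disc Y h                ≤⟨ ℤₚ.+-monoʳ-≤ (disc (flat G U) h)
      (sum-classes (λ y → span? (y ∷ c ∷ [])) (λ {y} → span-∈ (here refl)) w ts Y separated
        (λ y∈ → let y∈U , ¬Gy = ∈-filter⁻ ∉G? y∈ in
           class≤ ¬Gy (subst (disc (flat _ U) h ℤ.≤_) (sym (ℤₚ.+-identityʳ _)) (line≤ y∈U ¬Gy)))
        ts≁
        (All.map (λ (t∈ , ¬Gt , t≤) → ∈-filter⁺ ∉G? t∈ ¬Gt , class≤ ¬Gt t≤) ts≤)) ⟩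
    disc (flat G U) h ℤ.+ (ℤ.- (+ length ts))     ∎
    where
    open ℤₚ.≤-Reasoning
    w = λ y → sgn (ev h y)
    ∉G? : Decidable (λ y → ¬ Span G y)
    ∉G? y = ¬? (span? G y)
    Y = filter ∉G? U
    σ = disc (flat [ c ] U) h

    c⊂G : ∀ {v} → Span [ c ] v → Span G v
    c⊂G = span-mono λ { (here refl) → c∈G }

    separated : ∀ {t y z} → t ∈ Y → y ∈ Y → z ∈ Y → ¬ Span (t ∷ c ∷ []) y → Span (y ∷ c ∷ []) z → ¬ Span (t ∷ c ∷ []) z
    separated _ _ z∈ ¬ty yz tz = ¬ty (span-∷⁺ tz (λ { (here refl) → span-∈ (there (here refl)) })
      (exchange yz (λ cz → proj₂ (∈-filter⁻ ∉G? {xs = U} z∈) (c⊂G cz))))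

    -- An element of the line not parallel to `c` lies outside `G`, since otherwise exchange would
    -- put `y` into `G`. So the line is the class of `c` together with one class of `Y`.
    class-eq : ∀ {y} → ¬ Span G y → disc (flat (y ∷ c ∷ []) U) h ≡ σ ℤ.+ sumBy w (filter (span? (y ∷ c ∷ [])) Y)
    class-eq {y} ¬Gy = trans
      (sumBy-filter-⊎ (span? (y ∷ c ∷ [])) (span? [ c ]) (λ z → ∉G? z ×-dec span? (y ∷ c ∷ []) z) w U
        (λ _ yz ¬cz → (λ Gz → ¬Gy (span-∷⁺ Gz (λ { (here refl) → c∈G }) (exchange yz ¬cz))) , yz)
        (λ _ → span-weaken)
        (λ _ (¬Gz , yz) → yz , λ cz → ¬Gz (c⊂G cz)))
      (cong (λ l → σ ℤ.+ sumBy w l) (sym (filter-filter-× ∉G? (span? (y ∷ c ∷ [])) U)))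

    class≤ : ∀ {y a} → ¬ Span G y → disc (flat (y ∷ c ∷ []) U) h ℤ.≤ σ ℤ.+ a → sumBy w (filter (span? (y ∷ c ∷ [])) Y) ℤ.≤ a
    class≤ {y} {a} ¬Gy le = ℤ-+-cancelˡ-≤ σ (subst (ℤ._≤ σ ℤ.+ a) (class-eq ¬Gy) le)

  -- Independence in a different order, so that a functional can kill `y` and `z` but not `c`.
  rotate : ∀ {c y z} → ¬ Span [] c → ¬ Span [ c ] y → ¬ Span (y ∷ c ∷ []) z → ¬ Span (z ∷ y ∷ []) c
  rotate {c} {y} {z} ¬c ¬cy ¬cyz sp with span? [ y ] c
  ... | yes yc = ¬cy (exchange yc ¬c)
  ... | no ¬yc = ¬cyz (span-swap (exchange sp ¬yc))

  -- h kills y and z but not c: the lines through c then force disc U h < 0,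
  -- although disc U h = 0 because h kills y.
  no-independent-triple : ∀ {U c y z} → Reduced U → DiscLe 1 U → c ∈ U → y ∈ U → z ∈ U →
    ¬ Span [ c ] y → ¬ Span (y ∷ c ∷ []) z → ⊥
  no-independent-triple {U} {c} {y} {z} red le c∈ y∈ z∈ ¬cy ¬cyz
    with h , hz ∷ hy ∷ [] , 0<hc ← separate⁺ (rotate (reduced⇒nonzero red c∈) ¬cy ¬cyz) =
    contradiction (subst (ℤ._≤ -1ℤ) (disc-zero-≡ red le y∈ hy) disc≤-1) λ ()
    where
    c∈c : c ∈ flat [ c ] U
    c∈c = ∈-filter⁺ (span? [ c ]) c∈ (span-∈ (here refl))
    σ = disc (flat [ c ] U) h
    1≤σ : 1ℤ ℤ.≤ σ
    1≤σ = subst (1ℤ ℤ.≤_) (sym (disc-parallel (reduced-filter (span? [ c ]) red) c∈c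
            (λ z∈ → proj₂ (∈-filter⁻ (span? [ c ]) {xs = U} z∈)) 0<hc)) (+≤+ (∈⇒1≤length c∈c))
    line : ∀ {t} → t ∈ U → ev h t ≈ 0# → disc (flat (t ∷ c ∷ []) U) h ℤ.≤ σ ℤ.+ -1ℤ
    line t∈ ht = ℤₚ.≤-trans (disc-zero-≤ (reduced-filter (span? _) red) (disc-flat _ le)
      (∈-filter⁺ (span? _) t∈ (span-∈ (here refl))) ht) (ℤₚ.+-monoˡ-≤ -1ℤ 1≤σ)
    ¬cz : ¬ Span [ c ] z
    ¬cz cz = ¬cyz (span-weaken cz)
    -- The class of `c` contributes at most 1, and the distinct lines of `y` and `z` lose 1 each.
    disc≤-1 : disc U h ℤ.≤ -1ℤ
    disc≤-1 = ℤₚ.≤-trans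
      (disc-lines U [ c ] c h (y ∷ z ∷ []) (span-∈ (here refl))
        (λ _ _ → ℤₚ.≤-trans (disc≤ (disc-flat _ le) h) 1≤σ)
        ((y∈ , ¬cy , line y∈ hy) ∷ (z∈ , ¬cz , line z∈ hz) ∷ [])
        ((¬cyz ∷ []) ∷ [] ∷ []))
      (ℤₚ.+-monoˡ-≤ (ℤ.- + 2) (disc≤ (disc-flat [ c ] le) h))

  opaque
    span₂ : ∀ {U} → Reduced U → DiscLe 1 U → ∃ λ S → length S ℕ.≤ 2 × (∀ {u} → u ∈ U → Span S u)
    span₂ {U} red le with basis 2 U []
    ... | inj₁ (S , len , all) = S , len , λ u∈ → span-⊆ (++[]⊆ S) (all u∈)
    ... | inj₂ (c ∷ y ∷ z ∷ [] , refl , c∈ ∷ y∈ ∷ z∈ ∷ [] , _ , ¬cy , ¬cyz , _) =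
      ⊥-elim (no-independent-triple red le c∈ y∈ z∈ ¬cy ¬cyz)

  Opposites : List (X × X) → Set (x ⊔ φ)
  Opposites = All (λ (y , z) → Opp y z)

  -- If `z` is not parallel to `y`, or points the same way, a single functional nonzero at `z`
  -- refutes opposition.
  opp? : ∀ y z → ¬ Span [] z → Dec (Opp y z)
  opp? y z z≢0 with span? [ y ] z
  ... | no ¬sp with h , hy ∷ [] , hz ← separate ¬sp = no λ o → hz (sgn-zero⁻¹ (trans (o h) (cong ℤ.-_ (sgn-zero hy))))
  ... | yes sp with parallel sp z≢0
  ...   | inj₂ o = yes o
  ...   | inj₁ s with h , _ , 0<hz ← separate⁺ {[]} z≢0 = no λ o →
    contradiction (trans (sym (sgn-pos 0<hz)) (trans (o h) (cong ℤ.-_ (trans (sym (s h)) (sgn-pos 0<hz))))) λ ()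

  findOpp : ∀ y Y → (∀ {z} → z ∈ Y → ¬ Span [] z) → (∃ λ z → z ∈ Y × Opp y z) ⊎ (∀ {z} → z ∈ Y → ¬ Opp y z)
  findOpp y []      _  = inj₂ λ ()
  findOpp y (z ∷ Y) nz with opp? y z (nz (here refl)) | findOpp y Y (λ z∈ → nz (there z∈))
  ... | yes o | _                  = inj₁ (z , here refl , o)
  ... | no _  | inj₁ (u , u∈ , o)  = inj₁ (u , there u∈ , o)
  ... | no ¬o | inj₂ none          = inj₂ λ { (here refl) → ¬o ; (there u∈) → none u∈ }

  opaque
    -- Inserts the elements one by one, pairing each with an opposite among the unpaired ones
    -- whenever there is one.
    reduce : ∀ Y → (∀ {y} → y ∈ Y → ¬ Span [] y) →
      ∃ λ ps → ∃ λ U → Y ↭ pairs ps ++ U × Opposites ps × Reduced U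
    reduce []      _  = [] , [] , ↭-refl , [] , λ ()
    reduce (y ∷ Y) nz with ps , U , Y↭ , opps , red ← reduce Y (λ z∈ → nz (there z∈))
      with findOpp y U (reduced⇒nonzero red)
    ... | inj₁ (z , z∈ , o) with U′ , U↭ ← ∈⇒↭∷ z∈ =
      (y , z) ∷ ps , U′ ,
      prep y (↭-trans Y↭ (↭-trans (++⁺ˡ (pairs ps) U↭) (shift z (pairs ps) U′))) ,
      o ∷ opps , reduced-⊆ (λ u∈ → ∈-resp-↭ (↭-sym U↭) (there u∈)) red
    ... | inj₂ none = ps , y ∷ U , ↭-trans (prep y Y↭) (↭-sym (shift y (pairs ps) U)) , opps ,
      λ { (here refl) (here refl) o → nz (here refl) (self o)
        ; (here refl) (there z∈) → none z∈
        ; (there u∈) (here refl) o → none u∈ (opp-sym o)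
        ; (there u∈) (there z∈) → red u∈ z∈ }
      where
      x≡-x⇒x≡0 : ∀ {i} → i ≡ ℤ.- i → i ≡ 0ℤ
      x≡-x⇒x≡0 {+ zero} _ = refl
      self : Opp y y → Span [] y
      self o h _ = sgn-zero⁻¹ (x≡-x⇒x≡0 (o h))

  length-disc-nonzero : ∀ {Y h} → (∀ {y} → y ∈ Y → ¬ (ev h y ≈ 0#)) → ∃ λ n → + length Y ≡ disc Y h ℤ.+ + (2 ℕ.* n)
  length-disc-nonzero {Y} {h} nz with n , eq ← length-disc Y h =
    n , trans eq (cong (λ l → disc Y h ℤ.+ + l) (trans (cong (λ l → 2 ℕ.* n ℕ.+ length l)
      (filter-none (λ y → zero? (ev h y)) (All.tabulate nz))) (ℕₚ.+-identityʳ _)))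

  -- Perturb `h` to vanish nowhere on `Y` without lowering its discrepancy; the result then has the
  -- parity of `length Y` and cannot be 2.
  odd⇒disc-≤1 : ∀ {Y} → Reduced Y → Odd (length Y) → DiscLe 2 Y → DiscLe 1 Y
  odd⇒disc-≤1 {Y} red odd le .disc≤ h with g₀ , _ , gen ← generic [] Y with g , 0≤ , _ , from ← wlog-nonneg (zeros h Y) g₀ =
    ℤₚ.≤-trans h≤fun (≤2∧≢2⇒≤1 (disc≤ le fun) ≢2)
    where
    open _▹_On_ (compose h g Y)
    h≤fun : disc Y h ℤ.≤ disc Y fun
    h≤fun = subst₂ ℤ._≤_ (ℤₚ.+-identityʳ _) (sym (disc-compose (compose h g Y))) (ℤₚ.+-monoʳ-≤ (disc Y h) 0≤)
    nonzero : ∀ {y} → y ∈ Y → ¬ (ev fun y ≈ 0#)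
    nonzero y∈ = ▹-nonzero (compose h g Y) y∈ λ _ gy≈0 → gen y∈ (reduced⇒nonzero red y∈) (from gy≈0)
    ≢2 : disc Y fun ≢ + 2
    ≢2 eq with n , len ← length-disc-nonzero nonzero = ¬even×odd
      (suc n , trans (ℤₚ.+-injective (trans len (cong (ℤ._+ + (2 ℕ.* n)) eq))) (sym (ℕₚ.*-suc 2 n))) odd

  even⇒2≤disc : ∀ {Y h} → Even (length Y) → (∀ {y} → y ∈ Y → ¬ (ev h y ≈ 0#)) → 1ℤ ℤ.≤ disc Y h → + 2 ℤ.≤ disc Y h
  even⇒2≤disc {Y} {h} even nz 1≤ = 1≤∧≢1⇒2≤ 1≤ λ eq →
    let n , len = length-disc-nonzero nz in ¬even×odd even (n , ℤₚ.+-injective (trans len (cong (ℤ._+ + (2 ℕ.* n)) eq)))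

-- Even reduced families of rank at least 4 split into two odd families of discrepancy at most 1.

module Splitting {c ℓ₁ ℓ₂} (F : OrderedField c ℓ₁ ℓ₂) {x φ : Level} (𝒮 : Sign.Space F x φ) where
  open Sign F
  open Space 𝒮
  open Configurations F 𝒮
  open Discrepancy F 𝒮

  even-filter-pairs : ∀ {p} {P : Pred X p} (P? : Decidable P) ps → All (λ (y , z) → (P y → P z) × (P z → P y)) ps →
    Even (length (filter P? (pairs ps)))
  even-filter-pairs P? []             []               = 0 , refl
  even-filter-pairs P? ((y , z) ∷ ps) ((yz , zy) ∷ eqs) with even-filter-pairs P? ps eqs | P? y
  ... | k , eq | yes py with P? z
  ...   | yes _  = suc k , trans (cong (λ n → suc (suc n)) eq) (sym (ℕₚ.*-suc 2 k))
  ...   | no ¬pz = contradiction (yz py) ¬pz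
  even-filter-pairs P? ((y , z) ∷ ps) ((yz , zy) ∷ eqs) | k , eq | no ¬py with P? z
  ...   | yes pz = contradiction (zy pz) ¬py
  ...   | no _   = k , eq

  -- The hypothesis concerns the single `h`, so it also covers pairs that are opposite only modulo
  -- `c` when `h` kills `c`.
  disc-pairs : ∀ ps h → All (λ (y , z) → sgn (ev h z) ≡ ℤ.- sgn (ev h y)) ps → disc (pairs ps) h ≡ 0ℤ
  disc-pairs []             h []        = refl
  disc-pairs ((y , z) ∷ ps) h (o ∷ os) = trans (cong₂ (λ a b → s ℤ.+ (a ℤ.+ b)) o (disc-pairs ps h os))
    (trans (cong (λ a → s ℤ.+ a) (ℤₚ.+-identityʳ (ℤ.- s))) (ℤₚ.+-inverseʳ s))
    where s = sgn (ev h y)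

  rotate₃ : ∀ {c y z u} → ¬ Span [] c → ¬ Span [ c ] y → ¬ Span (y ∷ c ∷ []) z → ¬ Span (z ∷ y ∷ c ∷ []) u → ¬ Span (u ∷ z ∷ y ∷ []) c
  rotate₃ {c} {y} {z} {u} ¬c ¬cy ¬cyz ¬cyzu sp = ¬cyzu (span-⊆ perm (exchange sp (rotate ¬c ¬cy ¬cyz)))
    where
    perm : ∀ {v} → v ∈ c ∷ z ∷ y ∷ [] → v ∈ z ∷ y ∷ c ∷ []
    perm (here e)                 = there (there (here e))
    perm (there (here e))         = here e
    perm (there (there (here e))) = there (here e)

  restrict : ∀ {h g Y Z} → (∀ {y} → y ∈ Z → y ∈ Y) → h ▹ g On Y → h ▹ g On Z
  restrict sub k = record { fun = fun ; kills = kills ; sgn-fst = λ y∈ → sgn-fst (sub y∈) ; sgn-snd = sgn-snd }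
    where open _▹_On_ k

  module _ {U : List X} (red : Reduced U) (le : DiscLe 2 U) (even : Even (length U))
           (rank≥4 : ∀ S → length S ℕ.≤ 3 → ∃ λ u → u ∈ U × ¬ Span S u) where

    -- disc U h < 0 leaves the zeros of h a discrepancy of at most 1.
    zeros-independent : ∀ {h y z u} → disc U h ℤ.≤ -1ℤ → y ∈ U → z ∈ U → u ∈ U →
      ev h y ≈ 0# → ev h z ≈ 0# → ev h u ≈ 0# → ¬ Span [ y ] z → ¬ Span (z ∷ y ∷ []) u → ⊥
    zeros-independent {h} d≤ y∈ z∈ u∈ hy hz hu =
      no-independent-triple (reduced-filter zero′? red) le₁ (in-zeros y∈ hy) (in-zeros z∈ hz) (in-zeros u∈ hu)
      where
      zero′? = λ y → zero? (ev (neg h) y)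
      in-zeros : ∀ {v} → v ∈ U → ev h v ≈ 0# → v ∈ zeros (neg h) U
      in-zeros v∈ hv = ∈-filter⁺ zero′? v∈ (neg-zero hv)
      le₁ : DiscLe 1 (zeros (neg h) U)
      le₁ .disc≤ g = +≤⇒≤-1 1 (disc-local le (neg h) g) (subst (1ℤ ℤ.≤_) (sym (disc-neg U h)) (ℤₚ.neg-mono-≤ d≤))

    module _ {c : X} (c∈ : c ∈ U) where
      private
        ¬c : ¬ Span [] c
        ¬c = reduced⇒nonzero red c∈

        c∈[c] : c ∈ flat [ c ] U
        c∈[c] = ∈-filter⁺ (span? [ c ]) c∈ (span-∈ (here refl))

        σ≡ : ∀ {h} → 0# < ev h c → disc (flat [ c ] U) h ≡ + length (flat [ c ] U)
        σ≡ = disc-parallel (reduced-filter (span? [ c ]) red) c∈[c] (λ z∈ → proj₂ (∈-filter⁻ (span? [ c ]) {xs = U} z∈))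

      -- Choose `h` positive at `c` and killing three further independent elements. A doubled `c`
      -- has excess at least 2, which no line exceeds, and the three lines with a killed element
      -- lose 1 each; so `disc U h` is at most 2 - 3, against `zeros-independent`.
      no-double : ¬ (2 ℕ.≤ length (flat [ c ] U))
      no-double 2≤
        with y , y∈ , ¬cy ← rank≥4 (c ∷ []) (s≤s z≤n)
        with z , z∈ , ¬cyz ← rank≥4 (y ∷ c ∷ []) (s≤s (s≤s z≤n))
        with u , u∈ , ¬cyzu ← rank≥4 (z ∷ y ∷ c ∷ []) (s≤s (s≤s (s≤s z≤n)))
        with h , hu ∷ hz ∷ hy ∷ [] , 0<hc ← separate⁺ (rotate₃ ¬c ¬cy ¬cyz ¬cyzu) =
        zeros-independent d≤ y∈ z∈ u∈ hy hz hu
          (λ yz → ¬cyz (span-⊆ (λ { (here e) → here e }) yz))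
          (λ yzu → ¬cyzu (span-⊆ (λ { (here e) → here e ; (there (here e)) → there (here e) }) yzu))
        where
        2≤σ : + 2 ℤ.≤ disc (flat [ c ] U) h
        2≤σ = subst (+ 2 ℤ.≤_) (sym (σ≡ 0<hc)) (+≤+ 2≤)
        line : ∀ {t} → t ∈ U → ev h t ≈ 0# → disc (flat (t ∷ c ∷ []) U) h ℤ.≤ disc (flat [ c ] U) h ℤ.+ -1ℤ
        line t∈ ht = ℤₚ.≤-trans (disc-zero-≤ (reduced-filter (span? _) red) (disc-flat _ le)
          (∈-filter⁺ (span? _) t∈ (span-∈ (here refl))) ht) (ℤₚ.+-monoˡ-≤ -1ℤ 2≤σ)
        d≤ : disc U h ℤ.≤ -1ℤ
        d≤ = ℤₚ.≤-trans
          (disc-lines U [ c ] c h (y ∷ z ∷ u ∷ []) (span-∈ (here refl))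
            (λ _ _ → ℤₚ.≤-trans (disc≤ (disc-flat _ le) h) 2≤σ)
            ((y∈ , ¬cy , line y∈ hy) ∷ (z∈ , (λ cz → ¬cyz (span-weaken cz)) , line z∈ hz) ∷
             (u∈ , (λ cu → ¬cyzu (span-weaken (span-weaken cu))) , line u∈ hu) ∷ [])
            ((¬cyz ∷ (λ cyu → ¬cyzu (span-weaken cyu)) ∷ []) ∷
             ((λ czu → ¬cyzu (span-⊆ (λ { (here e) → here e ; (there (here e)) → there (there (here e)) }) czu)) ∷ []) ∷ [] ∷ []))
          (ℤₚ.+-monoˡ-≤ (ℤ.- + 3) (disc≤ (disc-flat [ c ] le) h))

      -- G will be the span of c and of the part that stays unpaired modulo c.
      module _ {S₀ : List X} (len : length S₀ ℕ.≤ 2)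
               (odd-line : ∀ {y} → y ∈ U → ¬ Span (c ∷ S₀) y → Odd (length (flat (y ∷ c ∷ []) U))) where
        private
          G : List X
          G = c ∷ S₀
          c∈G : Span G c
          c∈G = span-∈ (here refl)

          odd-disc : ∀ {y} → y ∈ U → ¬ Span G y → DiscLe 1 (flat (y ∷ c ∷ []) U)
          odd-disc y∈ ¬Gy = disc-flat-odd _ le even (odd-line y∈ ¬Gy)

          ∉c : ∀ {y} → ¬ Span G y → ¬ Span [ c ] y
          ∉c ¬Gy cy = ¬Gy (span-⊆ (λ { (here e) → here e }) cy)

        -- Otherwise some `h` is positive at `c` and kills `y`, `z` and a fourth independent `u`. An
        -- odd line has discrepancy at most 1, no more than the excess of `c`, and one with a killed
        -- element has at most 0.
        one-line : ∀ {y z} → y ∈ U → ¬ Span G y → z ∈ U → ¬ Span G z → Span (y ∷ c ∷ []) z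
        one-line {y} {z} y∈ ¬Gy z∈ ¬Gz with span? (y ∷ c ∷ []) z
        ... | yes cyz = cyz
        ... | no ¬cyz
          with u , u∈ , ¬cyzu ← rank≥4 (z ∷ y ∷ c ∷ []) (s≤s (s≤s (s≤s z≤n)))
          with h , hu ∷ hz ∷ hy ∷ [] , 0<hc ← separate⁺ (rotate₃ ¬c (∉c ¬Gy) ¬cyz ¬cyzu) =
          ⊥-elim (zeros-independent d≤ y∈ z∈ u∈ hy hz hu
            (λ yz → ¬cyz (span-⊆ (λ { (here e) → here e }) yz))
            (λ yzu → ¬cyzu (span-⊆ (λ { (here e) → here e ; (there (here e)) → there (here e) }) yzu)))
          where
          1≤σ : 1ℤ ℤ.≤ disc (flat [ c ] U) h
          1≤σ = subst (1ℤ ℤ.≤_) (sym (σ≡ 0<hc)) (+≤+ (∈⇒1≤length c∈[c]))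
          line : ∀ {t} → t ∈ U → ¬ Span G t → ev h t ≈ 0# → disc (flat (t ∷ c ∷ []) U) h ℤ.≤ disc (flat [ c ] U) h ℤ.+ -1ℤ
          line t∈ ¬Gt ht = ℤₚ.≤-trans (disc-zero-≤ (reduced-filter (span? _) red) (odd-disc t∈ ¬Gt)
            (∈-filter⁺ (span? _) t∈ (span-∈ (here refl))) ht) (ℤₚ.+-monoˡ-≤ -1ℤ 1≤σ)
          line≤ : ∀ {t} → t ∈ U → ¬ Span G t → disc (flat (t ∷ c ∷ []) U) h ℤ.≤ disc (flat [ c ] U) h
          line≤ t∈ ¬Gt = ℤₚ.≤-trans (disc≤ (odd-disc t∈ ¬Gt) h) 1≤σ
          d≤ : disc U h ℤ.≤ -1ℤ
          -- If `u` lies in `G`, the flat of `G` contributes at most 1 and two lines lose 1 each.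
          -- Otherwise it contributes at most 2 and the line of `u` is a third loss. Both give -1.
          d≤ with span? G u
          ... | yes Gu = ℤₚ.≤-trans
            (disc-lines U G c h (y ∷ z ∷ []) c∈G line≤
              ((y∈ , ¬Gy , line y∈ ¬Gy hy) ∷ (z∈ , ¬Gz , line z∈ ¬Gz hz) ∷ [])
              ((¬cyz ∷ []) ∷ [] ∷ []))
            (ℤₚ.+-monoˡ-≤ (ℤ.- + 2) (disc-zero-≤ (reduced-filter (span? G) red) (disc-flat G le) (∈-filter⁺ (span? G) u∈ Gu) hu))
          ... | no ¬Gu = ℤₚ.≤-trans
            (disc-lines U G c h (y ∷ z ∷ u ∷ []) c∈G line≤
              ((y∈ , ¬Gy , line y∈ ¬Gy hy) ∷ (z∈ , ¬Gz , line z∈ ¬Gz hz) ∷ (u∈ , ¬Gu , line u∈ ¬Gu hu) ∷ [])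
              ((¬cyz ∷ (λ cyu → ¬cyzu (span-weaken cyu)) ∷ []) ∷
               ((λ czu → ¬cyzu (span-⊆ (λ { (here e) → here e ; (there (here e)) → there (there (here e)) }) czu)) ∷ []) ∷ [] ∷ []))
            (ℤₚ.+-monoˡ-≤ (ℤ.- + 3) (disc≤ (disc-flat G le) h))

        -- As `G` is spanned by three vectors, some `x` lies outside. `W₁` is its line through `c`,
        -- odd by hypothesis; `W₂` is the rest, which lies in `G` by `one-line`.
        split-line : ∃ λ W₁ → ∃ λ W₂ → U ↭ W₁ ++ W₂ × Odd (length W₁) × Odd (length W₂) × DiscLe 1 W₁ × DiscLe 1 W₂
        split-line with x , x∈ , ¬Gx ← rank≥4 G (s≤s len) =
          W₁ x , W₂ x , U↭ x , odd-line x∈ ¬Gx ,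
          odd-+⁻ (subst Even (trans (↭-length (U↭ x)) (length-++ (W₁ x))) even) (odd-line x∈ ¬Gx) ,
          odd-disc x∈ ¬Gx , record { disc≤ = W₂≤ x∈ ¬Gx }
          where
          L? = λ x → span? (x ∷ c ∷ [])
          W₁ W₂ : X → List X
          W₁ x = flat (x ∷ c ∷ []) U
          W₂ x = filter (λ y → ¬? (L? x y)) U
          U↭ : ∀ x → U ↭ W₁ x ++ W₂ x
          U↭ x = filter-↭-++ (L? x) U
          W₂≤ : ∀ {x} → x ∈ U → ¬ Span G x → ∀ h → disc (W₂ x) h ℤ.≤ 1ℤ
          W₂≤ {x} x∈ ¬Gx h with zero? (ev h c)
          -- Here `h` kills `c`, an element of both `U` and `W₁`: the first has discrepancy at most
          -- 1 and the second exactly 0.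
          ... | yes hc = +≤⇒≤ (subst (ℤ._≤ 1ℤ) (sumBy-filter (L? x) _ U) (disc-zero-≤ red le c∈ hc))
            (ℤₚ.≤-reflexive (sym (disc-zero-≡ (reduced-filter (L? x) red) (odd-disc x∈ ¬Gx)
              (∈-filter⁺ (L? x) c∈ (span-∈ (there (here refl)))) hc)))
          -- Change h outside G so that x is just on the positive side.
          ... | no hc≉0 with k , kG , 0<kx ← separate⁺ ¬Gx =
            subst (ℤ._≤ 1ℤ) W₂-same (+≤⇒≤-1 1 (subst (ℤ._≤ + 2) (sumBy-filter (L? x) _ U) (disc≤ le fun)) 1≤W₁)
            where
            kx≉0 : ¬ (ev k x ≈ 0#)
            kx≉0 e = <-irrefl (≈-sym e) 0<kx
            t = proj₁ (solveLinear (ev h x) kx≉0)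
            h₁ = lin h t k
            h₁x : ev h₁ x ≈ 0#
            h₁x = ≈-trans (ev-lin h t k x) (proj₂ (solveLinear (ev h x) kx≉0))
            h₁G : ∀ {v} → Span G v → ev h₁ v ≈ ev h v
            h₁G {v} Gv = ≈-trans (ev-lin h t k v) (≈-trans (+-congˡ (≈-trans (*-congˡ (Gv k kG)) (zeroʳ t))) (+-identityʳ _))
            comp = compose h₁ k U
            open _▹_On_ comp
            redL = reduced-filter (L? x) red
            x∈L : x ∈ W₁ x
            x∈L = ∈-filter⁺ (L? x) x∈ (span-∈ (here refl))
            Z = zeros h₁ (W₁ x)
            x∈Z : x ∈ Z
            x∈Z = ∈-filter⁺ (λ z → zero? (ev h₁ z)) x∈L h₁x
            -- A zero of `h₁` on the line not parallel to `x` would make `h₁` kill `c`, where it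
            -- agrees with `h`.
            par : ∀ {z} → z ∈ Z → Span [ x ] z
            par {z} z∈Z with span? [ x ] z | ∈-filter⁻ (λ z → zero? (ev h₁ z)) {xs = W₁ x} z∈Z
            ... | yes sp | _         = sp
            ... | no ¬sp | z∈L , h₁z = contradiction
              (≈-trans (≈-sym (h₁G c∈G)) (exchange (span-swap (proj₂ (∈-filter⁻ (L? x) {xs = U} z∈L))) ¬sp h₁ (h₁z ∷ h₁x ∷ []))) hc≉0
            -- `h₁` has discrepancy 0 on `W₁` because it kills `x`; the perturbation by `k` then
            -- adds the class of `x`.
            1≤W₁ : 1ℤ ℤ.≤ disc (W₁ x) fun
            1≤W₁ = subst (1ℤ ℤ.≤_) (sym (trans (disc-compose (restrict (λ y∈ → proj₁ (∈-filter⁻ (L? x) {xs = U} y∈)) comp))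
                (trans (cong₂ ℤ._+_ (disc-zero-≡ redL (odd-disc x∈ ¬Gx) x∈L h₁x) (disc-parallel (reduced-filter _ redL) x∈Z par 0<kx)) (ℤₚ.+-identityˡ _))))
              (+≤+ (∈⇒1≤length x∈Z))
            -- `W₂` lies in `G`, where `k` vanishes and `h₁` agrees with `h`.
            W₂-same : disc (W₂ x) fun ≡ disc (W₂ x) h
            W₂-same = sumBy-cong (W₂ x) same
              where
              same : ∀ {y} → y ∈ W₂ x → sgn (ev fun y) ≡ sgn (ev h y)
              same {y} y∈ with y∈U , ¬Ly ← ∈-filter⁻ (λ y → ¬? (L? x y)) {xs = U} y∈ | span? G y
              ... | no ¬Gy = contradiction (one-line x∈ ¬Gx y∈U ¬Gy) ¬Ly
              ... | yes Gy with zero? (ev h₁ y)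
              ...   | no h₁y≉0 = trans (sgn-fst y∈U h₁y≉0) (sgn-cong (h₁G Gy))
              ...   | yes h₁y≈0 = trans (sgn-snd h₁y≈0) (trans (sgn-zero (Gy k kG)) (sym (sgn-zero (≈-trans (≈-sym (h₁G Gy)) h₁y≈0))))

      -- Works in the quotient by `c`: by `no-double` the other elements stay nonzero there, so they
      -- reduce to opposite pairs and a part `R`, spanned modulo `c` by at most two vectors.
      split-point : ∃ λ W₁ → ∃ λ W₂ → U ↭ W₁ ++ W₂ × Odd (length W₁) × Odd (length W₂) × DiscLe 1 W₁ × DiscLe 1 W₂
      split-point with Y , U↭ ← ∈⇒↭∷ c∈ with Q.reduce Y simple
        where
        module Q = Discrepancy F (quotient c)
        simple : ∀ {y} → y ∈ Y → ¬ (Space.Span (quotient c) [] y)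
        simple {y} y∈ sp = no-double (subst (2 ℕ.≤_) (sym (trans (↭-length (filter-↭ (span? [ c ]) U↭)) (cong length (filter-accept (span? [ c ]) {xs = Y} (span-∈ {[ c ]} (here refl))))))
          (s≤s (∈⇒1≤length (∈-filter⁺ (span? [ c ]) y∈ λ { h (hc ∷ []) → sp (h , hc) [] }))))
      ... | ps , R , Y↭ , opps , redR with Discrepancy.span₂ F (quotient c) redR leR
        where
        leR : Configurations.DiscLe F (quotient c) 1 R
        -- A functional on the quotient kills `c`, which lowers the bound on `U` from 2 to 1;
        -- neither `c` nor the pairs contribute.
        leR .Configurations.disc≤ (h , hc) = subst (ℤ._≤ 1ℤ) discU (disc-zero-≤ red le c∈ hc)
          where
          discU : disc U h ≡ disc R h
          discU = trans (sumBy-↭ _ U↭) (trans (cong₂ ℤ._+_ (sgn-zero hc)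
            (trans (sumBy-↭ _ Y↭) (trans (sumBy-++ _ (pairs ps) R)
              (trans (cong (ℤ._+ disc R h) (disc-pairs ps h (All.map (λ o → o (h , hc)) opps))) (ℤₚ.+-identityˡ (disc R h))))))
            (ℤₚ.+-identityˡ (disc R h)))
      ... | S₀ , len , R⊂ = split-line len odd-line
        where
        -- Besides `c` the line contains only complete pairs: with one member of a pair it contains
        -- the other, and an element of `R` on it would put `y` into `G` by exchange.
        odd-line : ∀ {y} → y ∈ U → ¬ Span (c ∷ S₀) y → Odd (length (flat (y ∷ c ∷ []) U))
        odd-line {y} _ ¬Gy = proj₁ even-pairs , (begin
            length (flat (y ∷ c ∷ []) U)                              ≡⟨ ↭-length (filter-↭ L? (↭-trans U↭ (prep c Y↭))) ⟩
            length (filter L? (c ∷ pairs ps ++ R))                    ≡⟨ cong length (filter-accept L? c∈L) ⟩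
            suc (length (filter L? (pairs ps ++ R)))                  ≡⟨ cong (λ l → suc (length l)) (filter-++ L? (pairs ps) R) ⟩
            suc (length (filter L? (pairs ps) ++ filter L? R))        ≡⟨ cong (λ l → suc (length (filter L? (pairs ps) ++ l))) (filter-none L? (All.tabulate ¬LR)) ⟩
            suc (length (filter L? (pairs ps) ++ []))                 ≡⟨ cong suc (trans (length-++ (filter L? (pairs ps))) (ℕₚ.+-identityʳ _)) ⟩
            suc (length (filter L? (pairs ps)))                       ≡⟨ cong suc (proj₂ even-pairs) ⟩
            suc (2 ℕ.* proj₁ even-pairs)                              ∎)
          where
          open ≡-Reasoning
          L? = span? (y ∷ c ∷ [])
          c∈L : Span (y ∷ c ∷ []) c
          c∈L = span-∈ (there (here refl))
          both : ∀ {b} → Configurations.Opp F (quotient c) (proj₁ b) (proj₂ b) →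
            (Span (y ∷ c ∷ []) (proj₁ b) → Span (y ∷ c ∷ []) (proj₂ b)) × (Span (y ∷ c ∷ []) (proj₂ b) → Span (y ∷ c ∷ []) (proj₁ b))
          both o = (λ sp h hL → zero₁ (o (h , c∈L h hL)) (sp h hL)) , (λ sp h hL → zero₁ (Configurations.opp-sym F (quotient c) o (h , c∈L h hL)) (sp h hL))
            where
            zero₁ : ∀ {a b} → sgn b ≡ ℤ.- sgn a → a ≈ 0# → b ≈ 0#
            zero₁ eq a≈0 = sgn-zero⁻¹ (trans eq (cong ℤ.-_ (sgn-zero a≈0)))
          even-pairs : Even (length (filter L? (pairs ps)))
          even-pairs = even-filter-pairs L? ps (All.map both opps)
          ¬LR : ∀ {r} → r ∈ R → ¬ Span (y ∷ c ∷ []) r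
          ¬LR {r} r∈ Lr = ¬Gy (span-∷⁺ (λ { h (hc ∷ hS) → R⊂ r∈ (h , hc) hS }) (λ { (here refl) → span-∈ (here refl) })
            (exchange Lr λ cr → Discrepancy.reduced⇒nonzero F (quotient c) redR r∈ λ (h , hc) _ → cr h (hc ∷ [])))

    opaque
      split : ∃ λ W₁ → ∃ λ W₂ → U ↭ W₁ ++ W₂ × Odd (length W₁) × Odd (length W₂) × DiscLe 1 W₁ × DiscLe 1 W₂
      split = split-point (proj₁ (proj₂ (rank≥4 [] z≤n)))

-- Coordinate spaces: combinations versus functionals, and rank.

module Coordinates {c ℓ₁ ℓ₂} (F : OrderedField c ℓ₁ ℓ₂) where
  open Sign F
  open import Algebra.Properties.CommutativeSemigroup +-commutativeSemigroup using (interchange)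

  ∑-cong : ∀ {n} {f g : Fin n → Carrier} → (∀ i → f i ≈ g i) → ∑ F f ≈ ∑ F g
  ∑-cong {zero}  eq = ≈-refl
  ∑-cong {suc n} eq = +-cong (eq Fin.zero) (∑-cong (λ i → eq (Fin.suc i)))

  ∑-lin : ∀ {n} (f : Fin n → Carrier) t g → ∑ F (λ i → f i + t * g i) ≈ ∑ F f + t * ∑ F g
  ∑-lin {zero}  f t g = ≈-sym (≈-trans (+-identityˡ _) (zeroʳ t))
  ∑-lin {suc n} f t g = ≈-trans (+-congˡ (∑-lin (λ i → f (Fin.suc i)) t (λ i → g (Fin.suc i))))
    (≈-trans (interchange _ _ _ _) (+-congˡ (≈-sym (distribˡ t _ _))))

  ∑-0 : ∀ {n} {f : Fin n → Carrier} → (∀ i → f i ≈ 0#) → ∑ F f ≈ 0#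
  ∑-0 {zero}  eq = ≈-refl
  ∑-0 {suc n} eq = ≈-trans (+-cong (eq Fin.zero) (∑-0 (λ i → eq (Fin.suc i)))) (+-identityˡ 0#)

  module _ {d : ℕ} where

    _⊕_·_ : Vector F d → Carrier → Vector F d → Vector F d
    (h ⊕ t · k) i = h i + t * k i

    ev-linˡ : ∀ h t k v → ⟪_,_⟫ F (h ⊕ t · k) v ≈ ⟪_,_⟫ F h v + t * ⟪_,_⟫ F k v
    ev-linˡ h t k v = ≈-trans (∑-cong (λ i → ≈-trans (distribʳ (v i) (h i) (t * k i)) (+-congˡ (*-assoc t (k i) (v i)))))
      (∑-lin (λ i → h i * v i) t (λ i → k i * v i))

    ev-linʳ : ∀ h v t w → ⟪_,_⟫ F h (v ⊕ t · w) ≈ ⟪_,_⟫ F h v + t * ⟪_,_⟫ F h w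
    ev-linʳ h v t w = ≈-trans (∑-cong (λ i → ≈-trans (distribˡ (h i) (v i) (t * w i)) (+-congˡ (x∙yz≈y∙xz (h i) t (w i)))))
      (∑-lin (λ i → h i * v i) t (λ i → h i * w i))

    ev-0 : ∀ v → ⟪_,_⟫ F (λ (_ : Fin d) → 0#) v ≈ 0#
    ev-0 v = ∑-0 (λ i → zeroˡ (v i))

    ev-zeroVec : ∀ h {v : Vector F d} → IsZeroVec F v → ⟪_,_⟫ F h v ≈ 0#
    ev-zeroVec h v≈0 = ∑-0 (λ i → ≈-trans (*-congˡ (v≈0 i)) (zeroʳ (h i)))

  unit : ∀ {d} → Fin d → Vector F d
  unit Fin.zero    Fin.zero    = 1#
  unit Fin.zero    (Fin.suc j) = 0#
  unit (Fin.suc i) Fin.zero    = 0#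
  unit (Fin.suc i) (Fin.suc j) = unit i j

  ev-unit : ∀ {d} (i : Fin d) v → ⟪_,_⟫ F (unit i) v ≈ v i
  ev-unit Fin.zero    v = ≈-trans (+-cong (*-identityˡ _) (∑-0 {f = λ i → 0# * v (Fin.suc i)} (λ i → zeroˡ _))) (+-identityʳ _)
  ev-unit (Fin.suc i) v = ≈-trans (+-cong (zeroˡ _) (ev-unit i (λ j → v (Fin.suc j)))) (+-identityˡ _)

  zeroVec? : ∀ {d} (v : Vector F d) → IsZeroVec F v ⊎ ∃ λ i → ¬ (v i ≈ 0#)
  zeroVec? v with Finₚ.all? (λ i → zero? (v i))
  ... | yes all = inj₁ all
  ... | no ¬all = inj₂ (Finₚ.¬∀⟶∃¬ _ (λ i → v i ≈ 0#) (λ i → zero? (v i)) ¬all)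

  module _ {d : ℕ} where

    -- `v` is corrected to zero by successive multiples, so these are the negatives of the usual
    -- coefficients.
    Combination : List (Vector F d) → Vector F d → Set (c ⊔ ℓ₁)
    Combination []      v = Level.Lift c (IsZeroVec F v)
    Combination (s ∷ S) v = ∃ λ t → Combination S (v ⊕ t · s)

    combination-cong : ∀ S {v w} → (∀ i → v i ≈ w i) → Combination S v → Combination S w
    combination-cong []      v≈w (Level.lift v≈0) = Level.lift λ i → ≈-trans (≈-sym (v≈w i)) (v≈0 i)
    combination-cong (s ∷ S) v≈w (t , comb)       = t , combination-cong S (λ i → +-congʳ (v≈w i)) comb

    combination⇒killed : ∀ S {v} → Combination S v → ∀ h → All (λ s → ⟪_,_⟫ F h s ≈ 0#) S → ⟪_,_⟫ F h v ≈ 0#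
    combination⇒killed []      (Level.lift v≈0) h _         = ev-zeroVec h v≈0
    combination⇒killed (s ∷ S) {v} (t , comb)   h (hs ∷ hS) = ≈-trans (≈-sym (≈-trans (ev-linʳ h v t s)
      (≈-trans (+-congˡ (≈-trans (*-congˡ hs) (zeroʳ t))) (+-identityʳ _)))) (combination⇒killed S comb h hS)

    combination⇒coefficients : ∀ S {v} → Combination S v →
      ∃ λ (a : Fin (length S) → Carrier) → ∀ i → v i + ∑ F (λ j → a j * lookup S j i) ≈ 0#
    combination⇒coefficients []      (Level.lift v≈0) = (λ ()) , λ i → ≈-trans (+-identityʳ _) (v≈0 i)
    combination⇒coefficients (s ∷ S) {v} (t , comb) with a , eq ← combination⇒coefficients S comb =
      (λ { Fin.zero → t ; (Fin.suc j) → a j }) , λ i → ≈-trans (≈-sym (+-assoc _ _ _)) (eq i)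

    opaque
      combination? : ∀ S v → Combination S v ⊎ ∃ λ h → All (λ s → ⟪_,_⟫ F h s ≈ 0#) S × ¬ (⟪_,_⟫ F h v ≈ 0#)
      combination? [] v with zeroVec? v
      ... | inj₁ v≈0      = inj₁ (Level.lift v≈0)
      ... | inj₂ (i , vi) = inj₂ (unit i , [] , λ e → vi (≈-trans (≈-sym (ev-unit i v)) e))
      combination? (s ∷ S) v with combination? S s
      ... | inj₁ comb with combination? S v
      ...   | inj₁ comb-v         = inj₁ (0# , combination-cong S (λ i → ≈-sym (≈-trans (+-congˡ (zeroˡ _)) (+-identityʳ _))) comb-v)
      ...   | inj₂ (h , hS , hv) = inj₂ (h , combination⇒killed S comb h hS ∷ hS , hv)
      combination? (s ∷ S) v | inj₂ (h₀ , h₀S , h₀s≉0) with t , eq ← solveLinear (⟪_,_⟫ F h₀ v) h₀s≉0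
        with combination? S (v ⊕ t · s)
      ...   | inj₁ comb = inj₁ (t , comb)
      ...   | inj₂ (h , hS , hv′) with u , eq′ ← solveLinear (⟪_,_⟫ F h s) h₀s≉0 =
        inj₂ (h₁ , h₁s ∷ All.zipWith (λ {w} (a , b) → ≈-trans (ev-linˡ h u h₀ w) (≈-trans (+-cong a (≈-trans (*-congˡ b) (zeroʳ u))) (+-identityʳ 0#))) (hS , h₀S) ,
              λ h₁v → hv′ (≈-trans (≈-sym h₁v′₁) (≈-trans h₁v′₂ h₁v)))
        where
        h₁ v′ : Vector F d
        h₁ = h ⊕ u · h₀
        h₁s : ⟪_,_⟫ F h₁ s ≈ 0#
        h₁s = ≈-trans (ev-linˡ h u h₀ s) eq′
        v′ = v ⊕ t · s
        -- The correction is invisible at `v′`, which `h₀` kills; the shift from `v` to `v′` is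
        -- invisible to `h₁`, which kills `s`.
        h₁v′₁ : ⟪_,_⟫ F h₁ v′ ≈ ⟪_,_⟫ F h v′
        h₁v′₁ = ≈-trans (ev-linˡ h u h₀ v′) (≈-trans (+-congˡ (≈-trans (*-congˡ (≈-trans (ev-linʳ h₀ v t s) eq)) (zeroʳ u))) (+-identityʳ _))
        h₁v′₂ : ⟪_,_⟫ F h₁ v′ ≈ ⟪_,_⟫ F h₁ v
        h₁v′₂ = ≈-trans (ev-linʳ h₁ v t s) (≈-trans (+-congˡ (≈-trans (*-congˡ h₁s) (zeroʳ t))) (+-identityʳ _))

  coordinateSpace : ℕ → Space c c
  coordinateSpace d = record
    { X       = Vector F d
    ; Φ       = Vector F d
    ; ev      = ⟪_,_⟫ F
    ; lin     = _⊕_·_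
    ; ev-lin  = ev-linˡ
    ; zeroΦ   = λ _ → 0#
    ; ev-zero = ev-0
    ; decSpan = dec
    }
    where
    dec : ∀ S v → (∀ h → All (λ s → ⟪_,_⟫ F h s ≈ 0#) S → ⟪_,_⟫ F h v ≈ 0#) ⊎
                  ∃ λ h → All (λ s → ⟪_,_⟫ F h s ≈ 0#) S × ¬ (⟪_,_⟫ F h v ≈ 0#)
    dec S v with combination? S v
    ... | inj₁ comb = inj₁ (combination⇒killed S comb)
    ... | inj₂ sep  = inj₂ sep

  module Rank {d : ℕ} where
    open Space (coordinateSpace d)
    open Configurations F (coordinateSpace d)

    linIndep-tail : ∀ (w : Vector F d) W → LinIndep F (w ∷ W) → LinIndep F W
    linIndep-tail w W ind a eq j = ind (λ { Fin.zero → 0# ; (Fin.suc j) → a j })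
      (λ i → ≈-trans (+-cong (zeroˡ _) (eq i)) (+-identityʳ 0#)) (Fin.suc j)

    -- A combination representing `w` is a linear relation with coefficient 1 at `w`.
    linIndep-head : ∀ (w : Vector F d) W → LinIndep F (w ∷ W) → ¬ Span W w
    linIndep-head w W ind sp with combination? W w
    ... | inj₂ (h , hW , hw) = hw (sp h hW)
    ... | inj₁ comb with a , eq ← combination⇒coefficients W comb =
      0≉1 (≈-sym (ind (λ { Fin.zero → 1# ; (Fin.suc j) → a j }) (λ i → ≈-trans (+-congʳ (*-identityˡ _)) (eq i)) Fin.zero))

    chain-∷ʳ : ∀ T {B t} → Chain B T → ¬ Span (T ʳ++ B) t → Chain B (T ++ [ t ])
    chain-∷ʳ []      _          ¬sp = ¬sp , tt
    chain-∷ʳ (u ∷ T) (¬u , ch) ¬sp = ¬u , chain-∷ʳ T ch ¬sp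

    -- The head of `W` is independent of the tail, while a chain tests each element against the
    -- earlier ones; hence the reversal.
    linIndep⇒chain : ∀ W → LinIndep F W → Chain [] (reverse W)
    linIndep⇒chain []      _   = tt
    linIndep⇒chain (w ∷ W) ind = subst (Chain []) (sym (unfold-reverse w W))
      (chain-∷ʳ (reverse W) (linIndep⇒chain W (linIndep-tail w W ind))
        (λ sp → linIndep-head w W ind (span-⊆ (λ s∈ → reverse⁻ (reverse⁻ s∈)) sp)))

    linIndep-length : ∀ {W} S → LinIndep F W → (∀ {w} → w ∈ W → Span S w) → length W ℕ.≤ length S
    linIndep-length {W} S ind sub = subst (ℕ._≤ length S) (length-reverse W)
      (steinitz (reverse W) S (linIndep⇒chain W ind) (λ t∈ → span-⊆ ∈-++⁺ˡ (sub (reverse⁻ t∈))))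

-- Labelled partitions, and codegree decompositions from blocks.

filter-map : ∀ {a b p} {A : Set a} {B : Set b} {P : Pred B p} (P? : Decidable P) (f : A → B) xs →
  filter P? (map f xs) ≡ map f (filter (λ x → P? (f x)) xs)
filter-map P? f []       = refl
filter-map P? f (x ∷ xs) with P? (f x)
... | yes _ = cong (f x ∷_) (filter-map P? f xs)
... | no _  = filter-map P? f xs

-- Every element carries the index of its list, so that a permutation of the concatenation
-- transports the labels.
labelled : ∀ {a} {A : Set a} (Ps : List (List A)) → List (A × Fin (length Ps))
labelled []       = []
labelled (P ∷ Ps) = map (_, Fin.zero) P ++ map (λ (v , i) → v , Fin.suc i) (labelled Ps)

unlabelled : ∀ {a} {A : Set a} (Ps : List (List A)) → map proj₁ (labelled Ps) ≡ concat Ps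
unlabelled []       = refl
unlabelled (P ∷ Ps) = trans (map-++ proj₁ (map (_, Fin.zero) P) _) (cong₂ _++_
  (trans (sym (map-∘ P)) (map-id P)) (trans (sym (map-∘ (labelled Ps))) (unlabelled Ps)))

filter-labelled : ∀ {a} {A : Set a} (Ps : List (List A)) i →
  map proj₁ (filter (λ l → proj₂ l ≟ᶠ i) (labelled Ps)) ≡ lookup Ps i
filter-labelled (P ∷ Ps) Fin.zero = begin
  map proj₁ (filter 0? (zs ++ ss))              ≡⟨ cong (map proj₁) (filter-++ 0? zs ss) ⟩
  map proj₁ (filter 0? zs ++ filter 0? ss)      ≡⟨ cong (map proj₁) (cong₂ _++_
      (filter-all 0? (All-map⁺ (All.tabulate (λ _ → refl))))
      (filter-none 0? none)) ⟩
  map proj₁ (zs ++ [])                          ≡⟨ map-++ proj₁ zs [] ⟩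
  map proj₁ zs ++ []                            ≡⟨ ++-identityʳ _ ⟩
  map proj₁ zs                                  ≡⟨ trans (sym (map-∘ P)) (map-id P) ⟩
  P                                             ∎
  where
  open ≡-Reasoning
  0? = λ l → proj₂ l ≟ᶠ Fin.zero
  zs = map (_, Fin.zero) P
  ss = map (λ (v , i) → v , Fin.suc i) (labelled Ps)
  none : All (λ l → ¬ (proj₂ l ≡ Fin.zero)) ss
  none = All-map⁺ (All.tabulate {xs = labelled Ps} (λ _ ()))
filter-labelled (P ∷ Ps) (Fin.suc i) = begin
  map proj₁ (filter s? (zs ++ ss))              ≡⟨ cong (map proj₁) (filter-++ s? zs ss) ⟩
  map proj₁ (filter s? zs ++ filter s? ss)      ≡⟨ cong (λ l → map proj₁ (l ++ filter s? ss)) (filter-none s? (All-map⁺ {xs = P} (All.tabulate (λ _ ())))) ⟩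
  map proj₁ (filter s? ss)                      ≡⟨ cong (map proj₁) (filter-map s? _ (labelled Ps)) ⟩
  map proj₁ (map (λ (v , i) → v , Fin.suc i) (filter (λ l → Fin.suc (proj₂ l) ≟ᶠ Fin.suc i) (labelled Ps)))
                                                ≡⟨ map-∘ (filter (λ l → Fin.suc (proj₂ l) ≟ᶠ Fin.suc i) (labelled Ps)) ⟨
  map proj₁ (filter (λ l → Fin.suc (proj₂ l) ≟ᶠ Fin.suc i) (labelled Ps))
                                                ≡⟨ cong (map proj₁) (filter-cong-∈ _ (λ l → proj₂ l ≟ᶠ i) (labelled Ps) (λ _ → Finₚ.suc-injective) (λ _ → cong Fin.suc)) ⟩
  map proj₁ (filter (λ l → proj₂ l ≟ᶠ i) (labelled Ps)) ≡⟨ filter-labelled Ps i ⟩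
  lookup Ps i                                   ∎
  where
  open ≡-Reasoning
  s? = λ l → proj₂ l ≟ᶠ Fin.suc i
  zs = map (_, Fin.zero) P
  ss = map (λ (v , i) → v , Fin.suc i) (labelled Ps)

module Decompose {c ℓ₁ ℓ₂} (F : OrderedField c ℓ₁ ℓ₂) {d : ℕ} where
  open Sign F
  open Coordinates F
  open Space (coordinateSpace d)
  open Configurations F (coordinateSpace d)

  part-∷ : ∀ {m} v V (lab : Fin (suc (length V)) → Fin (suc m)) i →
    part F {d} (v ∷ V) lab i ≡ map (lookup (v ∷ V)) (filter (λ j → lab j ≟ᶠ i) (Fin.zero ∷ [])) ++ part F V (lab ∘ Fin.suc) i
  part-∷ {m} v V lab i = trans (cong (map (lookup (v ∷ V))) (filter-++ i? (Fin.zero ∷ []) (tabulate Fin.suc)))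
    (trans (map-++ (lookup (v ∷ V)) (filter i? (Fin.zero ∷ [])) _) (cong (map (lookup (v ∷ V)) (filter i? (Fin.zero ∷ [])) ++_)
      (trans (cong (λ l → map (lookup (v ∷ V)) (filter i? l)) (sym (map-tabulate (λ j → j) Fin.suc)))
        (trans (cong (map (lookup (v ∷ V))) (filter-map i? Fin.suc (allFin (length V))))
          (sym (map-∘ (filter (λ j → i? (Fin.suc j)) (allFin (length V)))))))))
    where i? = λ j → lab j ≟ᶠ i

  label : ∀ {m} (L : List (Vector F d × Fin (suc m))) →
    ∃ λ lab → ∀ i → part F (map proj₁ L) lab i ≡ map proj₁ (filter (λ l → proj₂ l ≟ᶠ i) L)
  label []            = (λ ()) , λ _ → refl
  label {m} ((v , n) ∷ L) with lab′ , eq ← label L = lab , eq′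
    where
    lab : Fin (suc (length (map proj₁ L))) → Fin (suc m)
    lab Fin.zero    = n
    lab (Fin.suc j) = lab′ j
    eq′ : ∀ i → part F (v ∷ map proj₁ L) lab i ≡ map proj₁ (filter (λ l → proj₂ l ≟ᶠ i) ((v , n) ∷ L))
    eq′ i rewrite part-∷ v (map proj₁ L) lab i | eq i with n ≟ᶠ i
    ... | yes _ = refl
    ... | no _  = refl

  labelling : ∀ V V₀ Bs → V ↭ V₀ ++ concat Bs →
    ∃ λ lab → ∀ (i : Fin (suc (length Bs))) → part F {d} V lab i ↭ lookup (V₀ ∷ Bs) i
  labelling V V₀ Bs V↭ with L , refl , L↭ ← ↭-map-inv proj₁ (↭-trans (↭-reflexive (unlabelled (V₀ ∷ Bs))) (↭-sym V↭))
    with lab , eq ← label L = lab , λ i → ↭-trans (↭-reflexive (eq i))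
      (↭-trans (map⁺ proj₁ (filter-↭ (λ l → proj₂ l ≟ᶠ i) (↭-sym L↭))) (↭-reflexive (filter-labelled (V₀ ∷ Bs) i)))

  positive? : ∀ h v → Dec (0# < ev h v)
  positive? h v = 0# <? ev h v

  -- The same number as `nonposCount`, but counted without truncated subtraction, so that it is
  -- visibly additive.
  nonpos : Vector F d → Config F d → ℕ
  nonpos h V = length (filter (λ v → ¬? (positive? h v)) V)

  length≡pos+nonpos : ∀ h V → length V ≡ posCount F h V ℕ.+ nonpos h V
  length≡pos+nonpos h V = trans (↭-length (filter-↭-++ (positive? h) V)) (length-++ (filter (positive? h) V))

  nonposCount≡ : ∀ h V → nonposCount F h V ≡ nonpos h V
  nonposCount≡ h V = trans (cong (ℕ._∸ posCount F h V) (length≡pos+nonpos h V)) (ℕₚ.m+n∸m≡n (posCount F h V) _)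

  nonpos-++ : ∀ h V W → nonpos h (V ++ W) ≡ nonpos h V ℕ.+ nonpos h W
  nonpos-++ h V W = trans (cong length (filter-++ _ V W)) (length-++ (filter _ V))

  nonpos-↭ : ∀ h {V W} → V ↭ W → nonpos h V ≡ nonpos h W
  nonpos-↭ h p = ↭-length (filter-↭ _ p)

  -- The two sides differ by the number of zeros of `h`.
  pos≤disc+nonpos : ∀ h V → + posCount F h V ℤ.≤ disc V h ℤ.+ + nonpos h V
  pos≤disc+nonpos h []      = ℤₚ.≤-refl
  pos≤disc+nonpos h (v ∷ V) with 0# <? ev h v | compare (ev h v) 0#
  ... | yes p | tri< _ _ ¬p = contradiction p ¬p
  ... | yes p | tri≈ _ _ ¬p = contradiction p ¬p
  ... | yes _ | tri> _ _ _  = subst (1ℤ ℤ.+ + posCount F h V ℤ.≤_) (sym (ℤₚ.+-assoc 1ℤ (disc V h) _)) (ℤₚ.+-monoʳ-≤ 1ℤ (pos≤disc+nonpos h V))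
  ... | no _  | tri< _ _ _  = subst (+ posCount F h V ℤ.≤_)
          (solve 2 (λ a b → a :+ b := con -1ℤ :+ a :+ (con 1ℤ :+ b)) refl (disc V h) (+ nonpos h V)) (pos≤disc+nonpos h V)
    where open ℤ-Solver
  ... | no _  | tri≈ _ _ _  = ℤₚ.≤-trans (pos≤disc+nonpos h V) (ℤₚ.+-mono-≤ (ℤₚ.≤-reflexive (sym (ℤₚ.+-identityˡ (disc V h)))) (+≤+ (ℕₚ.n≤1+n _)))
  ... | no ¬p | tri> _ _ p  = contradiction p ¬p

  pos≡disc+nonpos : ∀ h V → (∀ {v} → v ∈ V → ¬ (ev h v ≈ 0#)) → + posCount F h V ≡ disc V h ℤ.+ + nonpos h V
  pos≡disc+nonpos h []      _ = refl
  pos≡disc+nonpos h (v ∷ V) nz with 0# <? ev h v | compare (ev h v) 0#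
  ... | yes p | tri< _ _ ¬p = contradiction p ¬p
  ... | yes p | tri≈ _ _ ¬p = contradiction p ¬p
  ... | yes _ | tri> _ _ _  = trans (cong (λ s → 1ℤ ℤ.+ s) (pos≡disc+nonpos h V (λ v∈ → nz (there v∈)))) (sym (ℤₚ.+-assoc 1ℤ (disc V h) _))
  ... | no _  | tri< _ _ _  = trans (pos≡disc+nonpos h V (λ v∈ → nz (there v∈)))
          (solve 2 (λ a b → a :+ b := con -1ℤ :+ a :+ (con 1ℤ :+ b)) refl (disc V h) (+ nonpos h V))
    where open ℤ-Solver
  ... | no _  | tri≈ _ e _  = contradiction e (nz (here refl))
  ... | no ¬p | tri> _ _ p  = contradiction p ¬p

  discValue≡disc : ∀ h V → discValue F h V ≡ disc V h
  discValue≡disc h []      = refl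
  discValue≡disc h (v ∷ V) with 0# <? ev h v | ev h v <? 0# | compare (ev h v) 0# | discValue≡disc h V
  ... | yes _ | no _  | tri> _ _ _  | ih = trans (ℤₚ.+-assoc 1ℤ (+ posCount F h V) (ℤ.- (+ negCount F h V))) (cong (λ s → 1ℤ ℤ.+ s) ih)
  ... | no _  | yes _ | tri< _ _ _  | ih = trans
          (solve 2 (λ a b → a :+ (:- (con 1ℤ :+ b)) := con -1ℤ :+ (a :+ (:- b))) refl (+ posCount F h V) (+ negCount F h V))
          (cong (λ s → -1ℤ ℤ.+ s) ih)
    where open ℤ-Solver
  ... | no _  | no _  | tri≈ _ _ _  | ih = trans ih (sym (ℤₚ.+-identityˡ _))
  ... | yes p | _     | tri< _ _ ¬p | _  = contradiction p ¬p
  ... | yes p | _     | tri≈ _ _ ¬p | _  = contradiction p ¬p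
  ... | no ¬p | _     | tri> _ _ p  | _  = contradiction p ¬p
  ... | _     | yes p | tri> ¬p _ _ | _  = contradiction p ¬p
  ... | _     | yes p | tri≈ ¬p _ _ | _  = contradiction p ¬p
  ... | _     | no ¬p | tri< p _ _  | _  = contradiction p ¬p

  private
    halve : ∀ {k m e} → 2 ℕ.* k ℕ.+ e ℕ.≤ 2 ℕ.* m ℕ.+ e → k ℕ.≤ m
    halve {k} {m} {e} le = ℕₚ.*-cancelˡ-≤ 2 (ℕₚ.+-cancelʳ-≤ e _ _ le)

    regroup : ∀ e n → (e ℕ.+ n) ℕ.+ n ≡ 2 ℕ.* n ℕ.+ e
    regroup = NS.solve 2 (λ e n → (e NS.:+ n) NS.:+ n NS.:= NS.con 2 NS.:* n NS.:+ e) refl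
      where
      import Data.Nat.Solver
      module NS = Data.Nat.Solver.+-*-Solver

  -- The positive elements exceed the nonpositive ones by at most `e`, so `length B` is at most
  -- twice the latter plus `e`.
  nonpos-≥ : ∀ {B k e} → length B ≡ 2 ℕ.* k ℕ.+ e → DiscLe e B → ∀ h → k ℕ.≤ nonpos h B
  nonpos-≥ {B} {k} {e} len le h = halve {k} {nonpos h B} {e} (begin
    2 ℕ.* k ℕ.+ e                             ≡⟨ len ⟨
    length B                                  ≡⟨ length≡pos+nonpos h B ⟩
    posCount F h B ℕ.+ nonpos h B             ≤⟨ ℕₚ.+-monoˡ-≤ (nonpos h B) pos≤ ⟩
    (e ℕ.+ nonpos h B) ℕ.+ nonpos h B         ≡⟨ regroup e (nonpos h B) ⟩
    2 ℕ.* nonpos h B ℕ.+ e                    ∎)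
    where
    open ℕₚ.≤-Reasoning
    pos≤ : posCount F h B ℕ.≤ e ℕ.+ nonpos h B
    pos≤ = ℤₚ.drop‿+≤+ (ℤₚ.≤-trans (pos≤disc+nonpos h B) (ℤₚ.+-monoˡ-≤ (+ nonpos h B) (disc≤ le h)))

  nonpos-≡ : ∀ {B k e h} → length B ≡ 2 ℕ.* k ℕ.+ e → disc B h ≡ + e → (∀ {v} → v ∈ B → ¬ (ev h v ≈ 0#)) → nonpos h B ≡ k
  nonpos-≡ {B} {k} {e} {h} len eq nz = sym (ℕₚ.*-cancelˡ-≡ k (nonpos h B) 2 (ℕₚ.+-cancelʳ-≡ e _ _ (begin
    2 ℕ.* k ℕ.+ e                             ≡⟨ len ⟨
    length B                                  ≡⟨ length≡pos+nonpos h B ⟩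
    posCount F h B ℕ.+ nonpos h B             ≡⟨ cong (ℕ._+ nonpos h B) (ℤₚ.+-injective (trans (pos≡disc+nonpos h B nz) (cong (ℤ._+ + nonpos h B) eq))) ⟩
    (e ℕ.+ nonpos h B) ℕ.+ nonpos h B         ≡⟨ regroup e (nonpos h B) ⟩
    2 ℕ.* nonpos h B ℕ.+ e                    ∎)))
    where open ≡-Reasoning

  -- One `h*` serves all blocks: their minima are attained simultaneously, which is what makes the
  -- codegrees add up.
  record Block (h* : Vector F d) (B : Config F d) : Set c where
    field
      codeg  : ℕ
      pos    : 1 ℕ.≤ codeg
      lower  : ∀ h → codeg ℕ.≤ nonpos h B
      attain : nonpos h* B ≡ codeg
  open Block

  codegs : ∀ {h* Bs} → All (Block h*) Bs → Fin (length Bs) → ℕ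
  codegs (b ∷ bs) Fin.zero    = codeg b
  codegs (b ∷ bs) (Fin.suc i) = codegs bs i

  codegs-lower : ∀ {h* Bs} (bs : All (Block h*) Bs) i h → codegs bs i ℕ.≤ nonpos h (lookup Bs i)
  codegs-lower (b ∷ bs) Fin.zero    = lower b
  codegs-lower (b ∷ bs) (Fin.suc i) = codegs-lower bs i

  codegs-pos : ∀ {h* Bs} (bs : All (Block h*) Bs) i → 1 ℕ.≤ codegs bs i
  codegs-pos (b ∷ bs) Fin.zero    = pos b
  codegs-pos (b ∷ bs) (Fin.suc i) = codegs-pos bs i

  codegs-attain : ∀ {h* Bs} (bs : All (Block h*) Bs) i → nonpos h* (lookup Bs i) ≡ codegs bs i
  codegs-attain (b ∷ bs) Fin.zero    = attain b
  codegs-attain (b ∷ bs) (Fin.suc i) = codegs-attain bs i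

  sum-codegs-lower : ∀ {h* Bs} (bs : All (Block h*) Bs) h → sumℕ F (codegs bs) ℕ.≤ nonpos h (concat Bs)
  sum-codegs-lower []       h = z≤n
  sum-codegs-lower {Bs = B ∷ Bs} (b ∷ bs) h = ℕₚ.≤-trans (ℕₚ.+-mono-≤ (lower b h) (sum-codegs-lower bs h))
    (ℕₚ.≤-reflexive (sym (nonpos-++ h B (concat Bs))))

  sum-codegs-attain : ∀ {h* Bs} (bs : All (Block h*) Bs) → nonpos h* (concat Bs) ≡ sumℕ F (codegs bs)
  sum-codegs-attain []       = refl
  sum-codegs-attain {h*} {B ∷ Bs} (b ∷ bs) = trans (nonpos-++ h* B (concat Bs)) (cong₂ ℕ._+_ (attain b) (sum-codegs-attain bs))

  -- The sum of the block bounds is a lower bound for `V`, and `h*` attains it because it is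
  -- positive on all of `V₀`.
  decomposition : ∀ {V V₀ Bs h*} → NonzeroFunctional F h* → V ↭ V₀ ++ concat Bs → nonpos h* V₀ ≡ 0 →
    All (Block h*) Bs → CodegStarDecomposition F V (length Bs)
  decomposition {V} {V₀} {Bs} {h*} h*≢0 V↭ V₀≡0 bs with lab , parts ← labelling V V₀ Bs V↭ =
    lab ,
    (λ i h _ → ℕₚ.≤-trans (codegs-pos bs i) (lower-part i h)) ,
    codegs bs ,
    (λ i → (h* , h*≢0 , trans (count-part h* i) (codegs-attain bs i)) , λ h _ → lower-part i h) ,
    (h* , h*≢0 , trans (count-V h*) (cong₂ ℕ._+_ V₀≡0 (sum-codegs-attain bs))) ,
    λ h _ → ℕₚ.≤-trans (sum-codegs-lower bs h) (ℕₚ.≤-trans (ℕₚ.m≤n+m _ _) (ℕₚ.≤-reflexive (sym (count-V h))))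
    where
    count-part : ∀ h i → nonposCount F h (part F V lab (Fin.suc i)) ≡ nonpos h (lookup Bs i)
    count-part h i = trans (nonposCount≡ h (part F V lab (Fin.suc i))) (nonpos-↭ h (parts (Fin.suc i)))
    lower-part : ∀ i h → codegs bs i ℕ.≤ nonposCount F h (part F V lab (Fin.suc i))
    lower-part i h = subst (codegs bs i ℕ.≤_) (sym (count-part h i)) (codegs-lower bs i h)
    count-V : ∀ h → nonposCount F h V ≡ nonpos h V₀ ℕ.+ nonpos h (concat Bs)
    count-V h = trans (nonposCount≡ h V) (trans (nonpos-↭ h V↭) (nonpos-++ h V₀ (concat Bs)))

-- Rank bounds and the case distinction on the unpaired part.

module Assembly {c ℓ₁ ℓ₂} (F : OrderedField c ℓ₁ ℓ₂) {d : ℕ} where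
  open Sign F
  open Coordinates F
  open Rank {d}
  open Space (coordinateSpace d)
  open Configurations F (coordinateSpace d)
  open Discrepancy F (coordinateSpace d)
  open Splitting F (coordinateSpace d) using (disc-pairs; split)
  open Decompose F {d}

  block : ∀ {h* B} k e → 1 ℕ.≤ k → length B ≡ 2 ℕ.* k ℕ.+ e → DiscLe e B → disc B h* ≡ + e →
    (∀ {v} → v ∈ B → ¬ (ev h* v ≈ 0#)) → Block h* B
  block {h*} {B} k e 1≤k len le eq nz = record
    { codeg = k ; pos = 1≤k ; lower = nonpos-≥ {B} len le ; attain = nonpos-≡ {B} {h = h*} len eq nz }

  span-[]⇒zero : ∀ {v} → Span [] v → IsZeroVec F v
  span-[]⇒zero {v} sp i = ≈-trans (≈-sym (ev-unit i v)) (sp (unit i) [])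

  zeroVec-disc : ∀ {h} V → IsZeroVec F h → disc V h ≡ 0ℤ
  zeroVec-disc V h≈0 = sumBy-0 V λ {v} _ → sgn-zero (∑-0 (λ i → ≈-trans (*-congʳ (h≈0 i)) (zeroˡ (v i))))

  pairList : Vector F d × Vector F d → Config F d
  pairList (y , z) = y ∷ z ∷ []

  concat-pairs : ∀ ps Bs → concat (map pairList ps ++ Bs) ≡ pairs ps ++ concat Bs
  concat-pairs []             Bs = refl
  concat-pairs ((y , z) ∷ ps) Bs = cong (λ l → y ∷ z ∷ l) (concat-pairs ps Bs)

  module Assemble (V : Config F d) {r : ℕ} {δ : ℤ} (irr : Irreducible F V)
    {W : Config F d} (W⊆V : W ⊆ V) (indep : LinIndep F W) (lenW : length W ≡ r)
    {h₀ : Vector F d} (h₀≢0 : NonzeroFunctional F h₀) (discV≤ : ∀ h → NonzeroFunctional F h → discValue F h V ℤ.≤ δ)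
    (δ≤2 : δ ℤ.≤ + 2) where

    Goal : Set (c ⊔ ℓ₁)
    Goal = ∃ λ m → (+ r ℤ.- δ ℤ.≤ + m) × CodegStarDecomposition F V m

    nonzero : ∀ {v} → v ∈ V → ¬ Span [] v
    nonzero v∈ sp = irr v∈ (span-[]⇒zero sp)

    module _ (ps : List (Vector F d × Vector F d)) (U : Config F d) (V↭ : V ↭ pairs ps ++ U)
      (opps : Opposites ps) (red : Reduced U) where

      discV≡ : ∀ h → discValue F h V ≡ disc U h
      discV≡ h = trans (discValue≡disc h V) (trans (sumBy-↭ _ V↭) (trans (sumBy-++ _ (pairs ps) U)
        (trans (cong (ℤ._+ disc U h) (disc-pairs ps h (All.map (λ o → o h) opps))) (ℤₚ.+-identityˡ _))))

      disc≤δ : ∀ {h} → NonzeroFunctional F h → disc U h ℤ.≤ δ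
      disc≤δ {h} h≢0 = subst (ℤ._≤ δ) (discV≡ h) (discV≤ h h≢0)

      le₂ : DiscLe 2 U
      le₂ .disc≤ h with zeroVec? h
      -- `discV≤` covers nonzero functionals only.
      ... | inj₁ h≈0      = subst (ℤ._≤ + 2) (sym (zeroVec-disc U h≈0)) (+≤+ z≤n)
      ... | inj₂ (i , hi) = ℤₚ.≤-trans (disc≤δ (λ h≈0 → hi (h≈0 i))) δ≤2

      span-pairs : ∀ ps → Opposites ps → ∀ {v} → v ∈ pairs ps → Span (map proj₁ ps) v
      span-pairs ((y , z) ∷ ps) (o ∷ os) (here refl)         = span-∈ (here refl)
      span-pairs ((y , z) ∷ ps) (o ∷ os) (there (here refl)) h (hy ∷ _) = sgn-zero⁻¹ (trans (o h) (cong ℤ.-_ (sgn-zero hy)))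
      span-pairs ((y , z) ∷ ps) (o ∷ os) (there (there v∈))  = span-weaken (span-pairs ps os v∈)

      -- The two members of a pair are proportional, so each pair adds at most one dimension.
      rank≤ : ∀ S → (∀ {u} → u ∈ U → Span S u) → r ℕ.≤ length ps ℕ.+ length S
      rank≤ S U⊂ = subst₂ ℕ._≤_ lenW (trans (length-++ (map proj₁ ps)) (cong (ℕ._+ length S) (length-map proj₁ ps)))
        (linIndep-length (map proj₁ ps ++ S) indep sub)
        where
        sub : ∀ {w} → w ∈ W → Span (map proj₁ ps ++ S) w
        sub w∈ with ∈-++⁻ (pairs ps) (∈-resp-↭ V↭ (Sublist.lookup W⊆V w∈))
        ... | inj₁ w∈ps = span-⊆ ∈-++⁺ˡ (span-pairs ps opps w∈ps)
        ... | inj₂ w∈U  = span-⊆ (∈-++⁺ʳ (map proj₁ ps)) (U⊂ w∈U)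

      module _ {g : Vector F d} (g-nz : ∀ {u} → u ∈ U → ¬ (ev g u ≈ 0#)) where
        private
          -- Here `h₀` is regarded as a vector: a functional nonzero at it is itself nonzero, even
          -- when `V` is empty.
          h₀V = h₀ ∷ V
          gen : ∃ λ k → Kills k [] × (∀ {v} → v ∈ h₀V → ¬ Span [] v → ¬ (ev k v ≈ 0#))
          gen = generic [] h₀V
          k = proj₁ gen
          -- `h*` keeps the signs of `g` on `U` and, through the generic `k`, vanishes on no element
          -- of the pairs.
          open _▹_On_ (compose g k h₀V) renaming (fun to h*)

          h*-nz : ∀ {v} → v ∈ h₀V → ¬ (ev h* v ≈ 0#)
          h*-nz v∈ = ▹-nonzero (compose g k h₀V) v∈ (λ _ → proj₂ (proj₂ gen) v∈ (v≢0 v∈))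
            where
            v≢0 : ∀ {v} → v ∈ h₀V → ¬ Span [] v
            v≢0 (here refl) sp = h₀≢0 (span-[]⇒zero sp)
            v≢0 (there v∈)     = nonzero v∈

          h*≢0 : NonzeroFunctional F h*
          h*≢0 h*≈0 = h*-nz (here refl) (∑-0 (λ i → ≈-trans (*-congʳ (h*≈0 i)) (zeroˡ (h₀ i))))

          U⊂V : ∀ {u} → u ∈ U → u ∈ V
          U⊂V u∈ = ∈-resp-↭ (↭-sym V↭) (∈-++⁺ʳ (pairs ps) u∈)

          h*≡g : ∀ {B} → (∀ {u} → u ∈ B → u ∈ U) → disc B h* ≡ disc B g
          h*≡g {B} B⊂ = sumBy-cong B (λ u∈ → sgn-fst (there (U⊂V (B⊂ u∈))) (g-nz (B⊂ u∈)))

          pair-blocks : ∀ ps → Opposites ps → (∀ {v} → v ∈ pairs ps → v ∈ V) → All (Block h*) (map pairList ps)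
          pair-blocks []             []       _   = []
          pair-blocks ((y , z) ∷ ps) (o ∷ os) sub =
            block 1 0 ℕₚ.≤-refl refl (record { disc≤ = λ h → ℤₚ.≤-reflexive (bal h) }) (bal h*)
              (λ { (here refl) → h*-nz (there (sub (here refl))) ; (there (here refl)) → h*-nz (there (sub (there (here refl)))) }) ∷
            pair-blocks ps os (λ v∈ → sub (there (there v∈)))
            where
            bal : ∀ h → disc (y ∷ z ∷ []) h ≡ 0ℤ
            bal h = disc-pairs ((y , z) ∷ []) h (o h ∷ [])

        -- `ρ` bounds the dimension of the span of `U`, and `E` is at most `δ` because the nonzero
        -- `h*` has discrepancy at least `E`. So `r - δ` is at most the number of pairs plus
        -- `ρ - E`, hence at most the number of parts.
        assemble : ∀ V₀ Bs E ρ → U ↭ V₀ ++ concat Bs → disc V₀ g ≡ + length V₀ →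
          All (λ B → ∃ λ k → ∃ λ e → 1 ℕ.≤ k × length B ≡ 2 ℕ.* k ℕ.+ e × DiscLe e B × disc B g ≡ + e) Bs →
          + E ℤ.≤ disc U g → r ℕ.≤ length ps ℕ.+ ρ → ρ ℕ.≤ length Bs ℕ.+ E → Goal
        assemble V₀ Bs E ρ U↭ V₀-pos blocks E≤ r≤ ρ≤ = length parts , bound ,
          decomposition h*≢0 V↭′ (nonpos-≡ {V₀} {0} {length V₀} {h*} refl (trans (h*≡g {V₀} V₀⊂) V₀-pos) (λ v∈ → h*-nz (there (U⊂V (V₀⊂ v∈)))))
            (All-++⁺ (pair-blocks ps opps (λ v∈ → ∈-resp-↭ (↭-sym V↭) (∈-++⁺ˡ v∈))) (mk-blocks Bs (λ v∈ → ∈-resp-↭ (↭-sym U↭) (∈-++⁺ʳ V₀ v∈)) blocks))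
          where
          parts = map pairList ps ++ Bs
          V₀⊂ : ∀ {v} → v ∈ V₀ → v ∈ U
          V₀⊂ v∈ = ∈-resp-↭ (↭-sym U↭) (∈-++⁺ˡ v∈)
          V↭′ : V ↭ V₀ ++ concat parts
          V↭′ = ↭-trans V↭ (↭-trans (++⁺ˡ (pairs ps) U↭) (↭-trans (shifts (pairs ps) V₀) (++⁺ˡ V₀ (↭-reflexive (sym (concat-pairs ps Bs))))))
          mk-blocks : ∀ Bs → (∀ {v} → v ∈ concat Bs → v ∈ U) →
            All (λ B → ∃ λ k → ∃ λ e → 1 ℕ.≤ k × length B ≡ 2 ℕ.* k ℕ.+ e × DiscLe e B × disc B g ≡ + e) Bs → All (Block h*) Bs
          mk-blocks []       _   []                                       = []
          mk-blocks (B ∷ Bs) sub ((k , e , 1≤k , len , le , eq) ∷ blocks) =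
            block k e 1≤k len le (trans (h*≡g {B} (λ v∈ → sub (∈-++⁺ˡ v∈))) eq) (λ v∈ → h*-nz (there (U⊂V (sub (∈-++⁺ˡ v∈))))) ∷
            mk-blocks Bs (λ v∈ → sub (∈-++⁺ʳ B v∈)) blocks
          E≤δ : + E ℤ.≤ δ
          E≤δ = ℤₚ.≤-trans E≤ (subst (ℤ._≤ δ) (h*≡g (λ u∈ → u∈)) (disc≤δ h*≢0))
          r≤′ : r ℕ.≤ length parts ℕ.+ E
          r≤′ = ℕₚ.≤-trans r≤ (ℕₚ.≤-trans (ℕₚ.+-monoʳ-≤ (length ps) ρ≤) (ℕₚ.≤-reflexive
            (trans (sym (ℕₚ.+-assoc (length ps) (length Bs) E))
              (cong (ℕ._+ E) (sym (trans (length-++ (map pairList ps)) (cong (ℕ._+ length Bs) (length-map pairList ps))))))))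
          bound : + r ℤ.- δ ℤ.≤ + length parts
          bound = subst (+ r ℤ.- δ ℤ.≤_) (trans (ℤₚ.+-assoc (+ length parts) (+ E) (ℤ.- + E)) (trans (cong (λ z → + length parts ℤ.+ z) (ℤₚ.+-inverseʳ (+ E))) (ℤₚ.+-identityʳ _)))
            (ℤₚ.+-mono-≤ (+≤+ r≤′) (ℤₚ.neg-mono-≤ E≤δ))

      module _ (g : Vector F d) (1≤ : 1ℤ ℤ.≤ disc U g) (g-nz : ∀ {u} → u ∈ U → ¬ (ev g u ≈ 0#)) where

        odd-case : Odd (length U) → Goal
        -- A single vector has codegree 0 and cannot be a block, so it goes to `V₀`; its dimension 1
        -- is paid for by `E = 1`.
        odd-case odd@(zero , len) = assemble g-nz U [] 1 (length U) (↭-sym (Perm-++-identityʳ U))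
          (trans disc≡1 (cong +_ (sym len))) [] 1≤ (rank≤ U span-∈) (ℕₚ.≤-reflexive len)
          where
          disc≡1 : disc U g ≡ 1ℤ
          disc≡1 = ℤₚ.≤-antisym (disc≤ (odd⇒disc-≤1 red odd le₂) g) 1≤
        -- One block of rank at most 2: one part plus `E = 1`.
        odd-case odd@(suc k , len) with S , lenS , U⊂ ← span₂ red (odd⇒disc-≤1 red odd le₂) =
          assemble g-nz [] (U ∷ []) 1 (length S) (↭-sym (Perm-++-identityʳ U)) refl
            ((suc k , 1 , s≤s z≤n , trans len (ℕₚ.+-comm 1 _) , le₁ , ℤₚ.≤-antisym (disc≤ le₁ g) 1≤) ∷ [])
            1≤ (rank≤ S U⊂) lenS
          where le₁ = odd⇒disc-≤1 red odd le₂

        -- Two blocks of rank at most 2 each, against two parts plus `E = 2`. As their discrepancies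
        -- at `g` sum to at least 2 and neither exceeds 1, both are exactly 1.
        rank≥4-case : Even (length U) → + 2 ℤ.≤ disc U g → (∀ S → length S ℕ.≤ 3 → ∃ λ u → u ∈ U × ¬ Span S u) → Goal
        rank≥4-case even 2≤ rank≥4
          with W₁ , W₂ , U↭ , (k₁ , len₁) , (k₂ , len₂) , leW₁ , leW₂ ← split red le₂ even rank≥4
          with S₁ , lenS₁ , W₁⊂ ← span₂ (reduced-⊆ (λ v∈ → ∈-resp-↭ (↭-sym U↭) (∈-++⁺ˡ v∈)) red) leW₁
          with S₂ , lenS₂ , W₂⊂ ← span₂ (reduced-⊆ (λ v∈ → ∈-resp-↭ (↭-sym U↭) (∈-++⁺ʳ W₁ v∈)) red) leW₂ =
          assemble g-nz [] (W₁ ∷ W₂ ∷ []) 2 (length (S₁ ++ S₂))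
            (↭-trans U↭ (++⁺ˡ W₁ (↭-sym (Perm-++-identityʳ W₂)))) refl
            ((k₁ , 1 , 1≤k₁ , trans len₁ (ℕₚ.+-comm 1 _) , leW₁ , ℤₚ.≤-antisym (disc≤ leW₁ g) (other (ℤₚ.≤-trans sum≥2 (ℤₚ.≤-reflexive (ℤₚ.+-comm (disc W₁ g) _))) (disc≤ leW₂ g))) ∷
             (k₂ , 1 , 1≤k₂ , trans len₂ (ℕₚ.+-comm 1 _) , leW₂ , ℤₚ.≤-antisym (disc≤ leW₂ g) (other sum≥2 (disc≤ leW₁ g))) ∷ [])
            2≤ (rank≤ (S₁ ++ S₂) (spans W₁⊂ W₂⊂))
            (subst (ℕ._≤ 4) (sym (length-++ S₁)) (ℕₚ.+-mono-≤ lenS₁ lenS₂))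
          where
          sum≥2 : + 2 ℤ.≤ disc W₁ g ℤ.+ disc W₂ g
          sum≥2 = subst (+ 2 ℤ.≤_) (trans (sumBy-↭ _ U↭) (sumBy-++ _ W₁ W₂)) 2≤
          other : ∀ {a b} → + 2 ℤ.≤ a ℤ.+ b → a ℤ.≤ 1ℤ → 1ℤ ℤ.≤ b
          other {a} {b} 2≤a+b a≤1 = ℤ-+-cancelˡ-≤ 1ℤ (ℤₚ.≤-trans 2≤a+b (ℤₚ.+-monoˡ-≤ b a≤1))
          spans : ∀ {S S′} → (∀ {v} → v ∈ W₁ → Span S v) → (∀ {v} → v ∈ W₂ → Span S′ v) → ∀ {u} → u ∈ U → Span (S ++ S′) u
          spans {S} W₁⊂ W₂⊂ u∈ with ∈-++⁻ W₁ (∈-resp-↭ U↭ u∈)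
          ... | inj₁ u∈W₁ = span-⊆ ∈-++⁺ˡ (W₁⊂ u∈W₁)
          ... | inj₂ u∈W₂ = span-⊆ (∈-++⁺ʳ S) (W₂⊂ u∈W₂)
          -- Used to give both blocks positive codegree: if one had a single element, three vectors
          -- would span `U`.
          large : ∀ {S S′} → (∀ {v} → v ∈ W₁ → Span S v) → (∀ {v} → v ∈ W₂ → Span S′ v) → ¬ (length S ℕ.+ length S′ ℕ.≤ 3)
          large {S} {S′} W₁⊂ W₂⊂ ≤3 = let u , u∈ , ¬sp = rank≥4 (S ++ S′) (subst (ℕ._≤ 3) (sym (length-++ S)) ≤3) in ¬sp (spans W₁⊂ W₂⊂ u∈)
          1≤half : ∀ k {n} → n ≡ suc (2 ℕ.* k) → ¬ (n ℕ.≤ 1) → 1 ℕ.≤ k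
          1≤half zero    refl ≰1 = contradiction ℕₚ.≤-refl ≰1
          1≤half (suc k) _    _  = s≤s z≤n
          1≤k₁ : 1 ℕ.≤ k₁
          1≤k₁ = 1≤half k₁ len₁ (λ ≤1 → large {W₁} {S₂} span-∈ W₂⊂ (ℕₚ.+-mono-≤ ≤1 lenS₂))
          1≤k₂ : 1 ℕ.≤ k₂
          1≤k₂ = 1≤half k₂ len₂ (λ ≤1 → large {S₁} {W₂} W₁⊂ span-∈ (ℕₚ.+-mono-≤ lenS₁ ≤1))

        even-case : Even (length U) → Goal
        even-case even with even⇒2≤disc even g-nz 1≤
        even-case (zero , len) | 2≤ = ⊥-elim (empty U len 2≤)
          where
          empty : ∀ U → length U ≡ 0 → ¬ (+ 2 ℤ.≤ disc U g)
          empty [] _ (+≤+ ())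
        -- Two vectors, both positive at `g`, form `V₀`; `E = 2` covers their rank.
        even-case (suc zero , len) | 2≤ = assemble g-nz U [] 2 (length U) (↭-sym (Perm-++-identityʳ U))
          (trans (ℤₚ.≤-antisym (disc≤ le₂ g) 2≤) (cong +_ (sym len))) [] 2≤ (rank≤ U span-∈) (ℕₚ.≤-reflexive len)
        even-case even@(suc (suc k) , len) | 2≤ with basis 3 U []
        -- Rank at most 3 equals one block plus `E = 2`; the length is `2 * suc k + 2`, so the
        -- codegree is `suc k`.
        ... | inj₁ (S , lenS , U⊂) =
          assemble g-nz [] (U ∷ []) 2 (length S) (↭-sym (Perm-++-identityʳ U)) refl
            ((suc k , 2 , s≤s z≤n , trans len (trans (ℕₚ.*-suc 2 (suc k)) (ℕₚ.+-comm 2 _)) , le₂ , ℤₚ.≤-antisym (disc≤ le₂ g) 2≤) ∷ [])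
            2≤ (rank≤ S (λ u∈ → span-⊆ (++[]⊆ S) (U⊂ u∈))) lenS
        ... | inj₂ (T , lenT , T⊂U , ch) = rank≥4-case even 2≤ rank≥4
          where
          rank≥4 : ∀ S → length S ℕ.≤ 3 → ∃ λ u → u ∈ U × ¬ Span S u
          rank≥4 S len≤3 with ∃∉span S U
          ... | inj₂ r = r
          ... | inj₁ all = contradiction (subst (ℕ._≤ 3) lenT (ℕₚ.≤-trans
                  (steinitz T S ch (λ t∈ → span-⊆ ∈-++⁺ˡ (all (All.lookup T⊂U t∈)))) len≤3)) (ℕₚ.<⇒≱ ℕₚ.≤-refl)

      goal : Goal
      goal with nonempty? U
        where
        nonempty? : ∀ (U : Config F d) → U ≡ [] ⊎ ∃ (_∈ U)
        nonempty? []      = inj₁ refl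
        nonempty? (u ∷ U) = inj₂ (u , here refl)
      -- With `U` empty any functional serves as `g`; the perturbation turns `zeroΦ` into a nonzero
      -- `h*`, which also yields `0 ≤ δ`.
      ... | inj₁ refl = assemble {zeroΦ} (λ ()) [] [] 0 0 ↭-refl refl [] ℤₚ.≤-refl (rank≤ [] (λ ())) z≤n
      ... | inj₂ (u , u∈) with g , 1≤ , g-nz ← disc-positive red u∈ with even⊎odd (length U)
      ...   | inj₁ even = even-case g 1≤ g-nz even
      ...   | inj₂ odd  = odd-case g 1≤ g-nz odd

    theorem : Goal
    theorem = let ps , U , V↭ , opps , red = reduce V nonzero in goal ps U V↭ opps red


open import Data.Integer using (_-_; _≤_)

mainTheorem1 : ∀ {c ℓ₁ ℓ₂} (F : OrderedField c ℓ₁ ℓ₂) (d : ℕ) (V : Config F d) (r : ℕ) (δ : ℤ) →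
    Irreducible F V → IsRank F V r → IsDisc F V δ → δ ≤ + 2 →
    ∃ λ (m : ℕ) → (+ r - δ ≤ + m) × CodegStarDecomposition F V m
mainTheorem1 F d V r δ irr ((W , W⊆V , indep , lenW) , _) ((h₀ , h₀≢0 , _) , discV≤) δ≤2 =
  Assembly.Assemble.theorem F V irr W⊆V indep lenW h₀≢0 discV≤ δ≤2
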